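{- Let $b\ge 2$ be an integer. Then, as $x\to\infty$, \[\sum_{n\leq x}h_b(n)= \frac{\zeta(2b-1)}{2\zeta(2b)}x^2+O_b(E_b(x)),\] where $E_2(x)=O(x\log x)$, and $E_b(x)=O(x)$ for $b\ge 3$.
   Context: For an integer $b\ge 2$ and positive integers $m,n$, the generalized gcd is $(m,n)_b:=\max\{d\ge 1: d^b\mid m \text{ and } d^b\mid n\}$. The generalized gcd-sum function is $h_b(n):=\sum_{1\le j\le n}(j,n)_b$. Here $\zeta$ is the Riemann zeta function, $x$ is a real variable, sums over $n\le x$ run over positive integers $n$, and $O_b$ means that the implied constant may depend on $b$. -}

module Defs where

open import Data.Integer.Base as ℤ using (+_; +[1+_]; -[1+_])
import Data.Integer.Properties as ℤₚ
open import Data.List.Base using (applyUpTo; filter; map)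
open import Data.List.Extrema.Nat using (max; ⊥≤max; xs≤max; argmax-sel)
open import Data.List.Membership.Propositional.Properties
  using (∈-applyUpTo⁺; ∈-filter⁺; ∈-filter⁻)
import Data.List.Relation.Unary.All as All
open import Data.Nat.Base as ℕ using (ℕ; zero; suc; z≤n; s≤s) hiding (module ℕ)
open import Data.Nat.Divisibility using (_∣_; _∣?_; 1∣_; ∣⇒≤)
open import Data.Nat.ListAction using (sum)
import Data.Nat.Properties as ℕₚ
open import Data.Product.Base using (∃; _×_; _,_; proj₁; proj₂)
open import Data.Rational.Base as ℚ using (ℚ; 0ℚ; 1ℚ; ½; mkℚ) hiding (module ℚ)
import Data.Rational.Properties as ℚₚ
open import Data.Rational.Solver using (module +-*-Solver)
open import Data.Rational.Unnormalised.Base as ℚᵘ using (mkℚᵘ)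
import Data.Rational.Unnormalised.Properties as ℚᵘₚ
open import Data.Sum.Base using (inj₁; inj₂)
open import Function.Base using (id)
open import Relation.Binary.PropositionalEquality
open import Relation.Nullary.Decidable.Core using (_×-dec_)
open import Algebra.Definitions.RawSemiring ℚ.+-*-rawSemiring using (_^_)

-- All d ≥ 1 with d ^ b ∣ m satisfy d ≤ m when b, m ≥ 1, so it is enough
-- to search 1, …, m; the default value 1 always belongs to the set.
gcd[_] : ℕ → ℕ → ℕ → ℕ
gcd[ b ] m n =
  max 1 (filter (λ d → (d ℕ.^ b ∣? m) ×-dec (d ℕ.^ b ∣? n)) (applyUpTo suc m))

gcd[]-isMaximum : ∀ b m n → 1 ℕ.≤ b → 1 ℕ.≤ m →
  let g = gcd[ b ] m n in
  1 ℕ.≤ g × g ℕ.^ b ∣ m × g ℕ.^ b ∣ n ×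
  (∀ d → 1 ℕ.≤ d → d ℕ.^ b ∣ m → d ℕ.^ b ∣ n → d ℕ.≤ g)
gcd[]-isMaximum b m n 1≤b 1≤m =
  ⊥≤max 1 ds , proj₁ g-divides , proj₂ g-divides , upper
  where
  P? = λ d → (d ℕ.^ b ∣? m) ×-dec (d ℕ.^ b ∣? n)
  ds = filter P? (applyUpTo suc m)

  g-divides : max 1 ds ℕ.^ b ∣ m × max 1 ds ℕ.^ b ∣ n
  g-divides with argmax-sel id 1 ds
  ... | inj₁ g≡1 rewrite g≡1 | ℕₚ.^-zeroˡ b = 1∣ m , 1∣ n
  ... | inj₂ g∈ds = proj₂ (∈-filter⁻ P? {xs = applyUpTo suc m} g∈ds)

  upper : ∀ d → 1 ℕ.≤ d → d ℕ.^ b ∣ m → d ℕ.^ b ∣ n → d ℕ.≤ max 1 ds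
  upper (suc d) _ d∣m d∣n =
    All.lookup (xs≤max 1 ds) (∈-filter⁺ P? (∈-applyUpTo⁺ suc d<m) (d∣m , d∣n))
    where
    d<m : suc d ℕ.≤ m
    d<m = ℕₚ.≤-trans
      (subst (ℕ._≤ suc d ℕ.^ b) (ℕₚ.^-identityʳ (suc d)) (ℕₚ.^-monoʳ-≤ (suc d) 1≤b))
      (∣⇒≤ {{ℕ.>-nonZero 1≤m}} d∣m)

∑₁ : ℕ → (ℕ → ℕ) → ℕ
∑₁ n f = sum (map f (applyUpTo suc n))

h : ℕ → ℕ → ℕ
h b n = ∑₁ n (λ j → gcd[ b ] j n)

Small : (ℕ → ℕ → ℚ) → Set
Small d = ∀ ε → 0ℚ ℚ.< ε →
  ∃ λ N → ∀ m n → N ℕ.≤ m → N ℕ.≤ n → d m n ℚ.≤ ε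

IsCauchy : (ℕ → ℚ) → Set
IsCauchy a = Small (λ m n → ℚ.∣ a m ℚ.- a n ∣)

∑< : ℕ → (ℕ → ℚ) → ℚ
∑< zero    a = 0ℚ
∑< (suc n) a = ∑< n a ℚ.+ a n

recip : (n : ℕ) → .{{ℕ.NonZero n}} → ℚ
recip n = + 1 ℚ./ n

-- 1 / (δ ⊔ q), which is 1 / q as soon as δ ≤ q.
clampedInverse : (δ : ℚ) → 0ℚ ℚ.< δ → ℚ → ℚ
clampedInverse δ 0<δ q =
  ℚ.1/_ (δ ℚ.⊔ q) {{ℚ.>-nonZero (ℚₚ.<-≤-trans 0<δ (ℚₚ.p≤p⊔q δ q))}}

ζ-term : ℕ → ℕ → ℚ
ζ-term s k = recip (suc k ℕ.^ s) {{ℕₚ.m^n≢0 (suc k) s}}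

logPartialSum : ℚ → ℕ → ℚ
logPartialSum u n = ∑< n (λ k → u ^ suc k ℚ.* recip (suc k))

module CauchyFacts where

  open ℚ using (_+_; _-_; _*_; -_; ∣_∣; _≤_; _<_; _⊔_)
  open +-*-Solver using (solve; _:+_; _:*_; :-_; _:-_; _:=_; con)

  nonNeg-* : ∀ {p q} → 0ℚ ≤ p → 0ℚ ≤ q → 0ℚ ≤ p * q
  nonNeg-* {p} {q} 0≤p 0≤q = ℚₚ.nonNegative⁻¹ (p * q)
    {{ℚₚ.nonNeg*nonNeg⇒nonNeg p {{ℚ.nonNegative 0≤p}} q {{ℚ.nonNegative 0≤q}}}}

  pos-* : ∀ {p q} → 0ℚ < p → 0ℚ < q → 0ℚ < p * q
  pos-* {p} {q} 0<p 0<q = ℚₚ.positive⁻¹ (p * q)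
    {{ℚₚ.pos*pos⇒pos p {{ℚ.positive 0<p}} q {{ℚ.positive 0<q}}}}

  *-monoˡ : ∀ {r p q} → 0ℚ ≤ r → p ≤ q → r * p ≤ r * q
  *-monoˡ {r} 0≤r p≤q = ℚₚ.*-monoˡ-≤-nonNeg r {{ℚ.nonNegative 0≤r}} p≤q

  *-monoʳ : ∀ {r p q} → 0ℚ ≤ r → p ≤ q → p * r ≤ q * r
  *-monoʳ {r} 0≤r p≤q = ℚₚ.*-monoʳ-≤-nonNeg r {{ℚ.nonNegative 0≤r}} p≤q

  *-mono : ∀ {p q r s} → 0ℚ ≤ p → 0ℚ ≤ s → p ≤ q → r ≤ s → p * r ≤ q * s
  *-mono 0≤p 0≤s p≤q r≤s = ℚₚ.≤-trans (*-monoˡ 0≤p r≤s) (*-monoʳ 0≤s p≤q)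

  inverse-pos : ∀ {p} (0<p : 0ℚ < p) → 0ℚ < ℚ.1/_ p {{ℚ.>-nonZero 0<p}}
  inverse-pos {p} 0<p = ℚₚ.positive⁻¹ _ {{ℚₚ.1/pos⇒pos p {{ℚ.positive 0<p}}}}

  0≤1 : 0ℚ ≤ 1ℚ
  0≤1 = ℚ.*≤* (ℤ.+≤+ z≤n)

  0<1 : 0ℚ < 1ℚ
  0<1 = ℚ.*<* (ℤ.+<+ (s≤s z≤n))

  0<½ : 0ℚ < ½
  0<½ = ℚ.*<* (ℤ.+<+ (s≤s z≤n))

  ∣-∣-sym : ∀ p q → ∣ p - q ∣ ≡ ∣ q - p ∣
  ∣-∣-sym p q = trans (cong ∣_∣ (solve 2 (λ p q → p :- q := :- (q :- p)) refl p q))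
                      (ℚₚ.∣-p∣≡∣p∣ (q - p))

  p≤∣p∣ : ∀ p → p ≤ ∣ p ∣
  p≤∣p∣ p with ℚₚ.≤-total 0ℚ p
  ... | inj₁ 0≤p = ℚₚ.≤-reflexive (sym (ℚₚ.0≤p⇒∣p∣≡p 0≤p))
  ... | inj₂ p≤0 = ℚₚ.≤-trans p≤0 (ℚₚ.0≤∣p∣ p)

  ∣p∣≤ : ∀ {p q} → p ≤ q → - p ≤ q → ∣ p ∣ ≤ q
  ∣p∣≤ {p} p≤q -p≤q with ℚₚ.∣p∣≡p∨∣p∣≡-p p
  ... | inj₁ e = subst (_≤ _) (sym e) p≤q
  ... | inj₂ e = subst (_≤ _) (sym e) -p≤q

  ≤⇒0≤- : ∀ {p q} → p ≤ q → 0ℚ ≤ q - p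
  ≤⇒0≤- {p} {q} p≤q = subst (_≤ q - p) (ℚₚ.+-inverseʳ p) (ℚₚ.+-monoˡ-≤ (- p) p≤q)

  0≤-⇒≤ : ∀ {p q} → 0ℚ ≤ q - p → p ≤ q
  0≤-⇒≤ {p} {q} 0≤ = subst₂ _≤_ (ℚₚ.+-identityˡ p)
    (solve 2 (λ p q → (q :- p) :+ p := q) refl p q) (ℚₚ.+-monoˡ-≤ p 0≤)

  p≤p+q : ∀ {p q} → 0ℚ ≤ q → p ≤ p + q
  p≤p+q {p} {q} 0≤q = subst (_≤ p + q) (ℚₚ.+-identityʳ p) (ℚₚ.+-monoʳ-≤ p 0≤q)

  q≤p+q : ∀ {p q} → 0ℚ ≤ p → q ≤ p + q
  q≤p+q {p} {q} 0≤p = subst (_≤ p + q) (ℚₚ.+-identityˡ q) (ℚₚ.+-monoˡ-≤ q 0≤p)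

  private
    ⊔ˡ : ∀ {a b k} → a ℕ.⊔ b ℕ.≤ k → a ℕ.≤ k
    ⊔ˡ {a} {b} = ℕₚ.≤-trans (ℕₚ.m≤m⊔n a b)

    ⊔ʳ : ∀ {a b k} → a ℕ.⊔ b ℕ.≤ k → b ℕ.≤ k
    ⊔ʳ {a} {b} = ℕₚ.≤-trans (ℕₚ.m≤n⊔m a b)

  small-mono : ∀ {d e} M → (∀ m n → M ℕ.≤ m → M ℕ.≤ n → d m n ≤ e m n) →
               Small e → Small d
  small-mono M d≤e se ε 0<ε with se ε 0<ε
  ... | N , e≤ε = M ℕ.⊔ N , λ m n m≥ n≥ →
    ℚₚ.≤-trans (d≤e m n (⊔ˡ m≥) (⊔ˡ n≥)) (e≤ε m n (⊔ʳ {M} m≥) (⊔ʳ {M} n≥))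

  small-+ : ∀ {d e} → Small d → Small e → Small (λ m n → d m n + e m n)
  small-+ {d} {e} sd se ε 0<ε with sd (½ * ε) (pos-* 0<½ 0<ε) | se (½ * ε) (pos-* 0<½ 0<ε)
  ... | M , d≤ | N , e≤ = M ℕ.⊔ N , λ m n m≥ n≥ →
    subst (d m n + e m n ≤_)
      (solve 1 (λ ε → con ½ :* ε :+ con ½ :* ε := ε) refl ε)
      (ℚₚ.+-mono-≤ (d≤ m n (⊔ˡ m≥) (⊔ˡ n≥)) (e≤ m n (⊔ʳ {M} m≥) (⊔ʳ {M} n≥)))

  small-* : ∀ {d} K → 0ℚ < K → Small d → Small (λ m n → K * d m n)
  small-* {d} K 0<K sd ε 0<ε with sd (1/K * ε) (pos-* (inverse-pos 0<K) 0<ε)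
    where 1/K = ℚ.1/_ K {{ℚ.>-nonZero 0<K}}
  ... | N , d≤ = N , λ m n m≥ n≥ →
    subst (K * d m n ≤_)
      (trans (sym (ℚₚ.*-assoc K _ ε))
        (trans (cong (_* ε) (ℚₚ.*-inverseʳ K {{ℚ.>-nonZero 0<K}})) (ℚₚ.*-identityˡ ε)))
      (*-monoˡ (ℚₚ.<⇒≤ 0<K) (d≤ m n m≥ n≥))

  small-0 : Small (λ m n → 0ℚ)
  small-0 ε 0<ε = 0 , λ _ _ _ _ → ℚₚ.<⇒≤ 0<ε

  private
    toℚᵘ-recip : ∀ n → ℚ.toℚᵘ (recip (suc n)) ℚᵘ.≃ mkℚᵘ (+ 1) n
    toℚᵘ-recip n = ℚₚ.toℚᵘ-fromℚᵘ (mkℚᵘ (+ 1) n)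

  recip-antimono : ∀ m n .{{_ : ℕ.NonZero m}} .{{_ : ℕ.NonZero n}} →
                   m ℕ.≤ n → recip n ≤ recip m
  recip-antimono (suc m) (suc n) m≤n = ℚₚ.toℚᵘ-cancel-≤
    (ℚᵘₚ.≤-respʳ-≃ (ℚᵘₚ.≃-sym (toℚᵘ-recip m))
      (ℚᵘₚ.≤-respˡ-≃ (ℚᵘₚ.≃-sym (toℚᵘ-recip n))
        (ℚᵘ.*≤* (ℤₚ.*-monoˡ-≤-nonNeg (+ 1) (ℤ.+≤+ m≤n)))))

  0<recip : ∀ n .{{_ : ℕ.NonZero n}} → 0ℚ < recip n
  0<recip n = ℚₚ.positive⁻¹ (recip n) {{ℚₚ.normalize-pos 1 n}}

  0≤recip : ∀ n .{{_ : ℕ.NonZero n}} → 0ℚ ≤ recip n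
  0≤recip n = ℚₚ.<⇒≤ (0<recip n)

  fromNat : ℕ → ℚ
  fromNat zero    = 0ℚ
  fromNat (suc n) = 1ℚ + fromNat n

  fromNat-/1 : ∀ n → ℚ.toℚᵘ (fromNat n) ℚᵘ.≃ mkℚᵘ (+ n) 0
  fromNat-/1 zero    = ℚᵘ.*≡* refl
  fromNat-/1 (suc n) = ℚᵘₚ.≃-trans (ℚₚ.toℚᵘ-homo-+ 1ℚ (fromNat n))
    (ℚᵘₚ.≃-trans (ℚᵘₚ.+-congʳ (ℚ.toℚᵘ 1ℚ) (fromNat-/1 n))
      (ℚᵘ.*≡* (cong (ℤ._* + 1) (cong (λ t → + 1 ℤ.+ t) (ℤₚ.*-identityʳ (+ n))))))

  recip-inverse : ∀ n → recip (suc n) * fromNat (suc n) ≡ 1ℚ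
  recip-inverse n = ℚₚ.toℚᵘ-injective
    (ℚᵘₚ.≃-trans (ℚₚ.toℚᵘ-homo-* (recip (suc n)) (fromNat (suc n)))
      (ℚᵘₚ.≃-trans (ℚᵘₚ.*-cong (toℚᵘ-recip n) (fromNat-/1 (suc n)))
        (ℚᵘ.*≡* (trans (ℤₚ.*-identityʳ _)
          (trans (ℤₚ.*-identityˡ (+ suc n))
            (sym (trans (ℤₚ.*-identityˡ _)
              (cong (λ t → + suc t) (ℕₚ.*-identityʳ n)))))))))

  recip-* : ∀ m n → recip (suc m ℕ.* suc n) ≡ recip (suc m) * recip (suc n)
  recip-* m n = ℚₚ.toℚᵘ-injective
    (ℚᵘₚ.≃-trans (toℚᵘ-recip (n ℕ.+ m ℕ.* suc n))
      (ℚᵘₚ.≃-sym (ℚᵘₚ.≃-trans (ℚₚ.toℚᵘ-homo-* (recip (suc m)) (recip (suc n)))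
        (ℚᵘₚ.≃-trans (ℚᵘₚ.*-cong (toℚᵘ-recip m) (toℚᵘ-recip n)) (ℚᵘ.*≡* refl)))))

  archimedean : ∀ ε → 0ℚ < ε → ∃ λ N → recip (suc N) ≤ ε
  archimedean (mkℚ +[1+ n ] d c) _ = d , ℚₚ.toℚᵘ-cancel-≤
    (ℚᵘₚ.≤-respˡ-≃ (ℚᵘₚ.≃-sym (toℚᵘ-recip d))
      (ℚᵘ.*≤* (ℤₚ.*-monoʳ-≤-nonNeg (+ suc d) {+ 1} {+[1+ n ]} (ℤ.+≤+ (s≤s z≤n)))))
  archimedean (mkℚ (+ 0) d c)      (ℚ.*<* (ℤ.+<+ ()))
  archimedean (mkℚ -[1+ n ] d c)   (ℚ.*<* ())

  small-recipˡ : Small (λ m n → recip (suc (ℕ.pred m)))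
  small-recipˡ ε 0<ε with archimedean ε 0<ε
  ... | N , r≤ε = suc N , λ m n m≥ n≥ → ℚₚ.≤-trans
    (recip-antimono (suc N) (suc (ℕ.pred m)) (s≤s (ℕₚ.pred-mono-≤ m≥))) r≤ε

  small-recipʳ : Small (λ m n → recip (suc (ℕ.pred n)))
  small-recipʳ ε 0<ε with small-recipˡ ε 0<ε
  ... | N , r≤ε = N , λ m n m≥ n≥ → r≤ε n m n≥ m≥

  const-cauchy : ∀ q → IsCauchy (λ _ → q)
  const-cauchy q = small-mono 0
    (λ _ _ _ _ → ℚₚ.≤-reflexive (cong ∣_∣ (ℚₚ.+-inverseʳ q))) small-0

  +-cauchy : ∀ {a b} → IsCauchy a → IsCauchy b → IsCauchy (λ n → a n + b n)
  +-cauchy {a} {b} ca cb = small-mono 0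
    (λ m n _ _ → subst (λ t → ∣ t ∣ ≤ ∣ a m - a n ∣ + ∣ b m - b n ∣)
      (solve 4 (λ x y z w → (x :- y) :+ (z :- w) := (x :+ z) :- (y :+ w)) refl
        (a m) (a n) (b m) (b n))
      (ℚₚ.∣p+q∣≤∣p∣+∣q∣ (a m - a n) (b m - b n)))
    (small-+ ca cb)

  neg-cauchy : ∀ {a} → IsCauchy a → IsCauchy (λ n → - a n)
  neg-cauchy {a} ca = small-mono 0
    (λ m n _ _ → ℚₚ.≤-reflexive (trans
      (cong ∣_∣ (solve 2 (λ x y → :- x :- :- y := :- (x :- y)) refl (a m) (a n)))
      (ℚₚ.∣-p∣≡∣p∣ (a m - a n)))) ca

  ∣∣p∣-∣q∣∣≤∣p-q∣ : ∀ p q → ∣ ∣ p ∣ - ∣ q ∣ ∣ ≤ ∣ p - q ∣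
  ∣∣p∣-∣q∣∣≤∣p-q∣ p q = ∣p∣≤ (go p q)
    (subst₂ _≤_ (solve 2 (λ x y → y :- x := :- (x :- y)) refl ∣ p ∣ ∣ q ∣)
      (∣-∣-sym q p) (go q p))
    where
    go : ∀ p q → ∣ p ∣ - ∣ q ∣ ≤ ∣ p - q ∣
    go p q = subst (∣ p ∣ - ∣ q ∣ ≤_)
      (solve 2 (λ x y → (x :+ y) :- y := x) refl ∣ p - q ∣ ∣ q ∣)
      (ℚₚ.+-monoˡ-≤ (- ∣ q ∣)
        (subst (λ t → ∣ t ∣ ≤ ∣ p - q ∣ + ∣ q ∣)
          (solve 2 (λ x y → (x :- y) :+ y := x) refl p q)
          (ℚₚ.∣p+q∣≤∣p∣+∣q∣ (p - q) q)))

  abs-cauchy : ∀ {a} → IsCauchy a → IsCauchy (λ n → ∣ a n ∣)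
  abs-cauchy {a} ca = small-mono 0 (λ m n _ _ → ∣∣p∣-∣q∣∣≤∣p-q∣ (a m) (a n)) ca

  bounded : ∀ {a} → IsCauchy a →
            ∃ λ B → 1ℚ ≤ B × ∃ λ N → ∀ n → N ℕ.≤ n → ∣ a n ∣ ≤ B
  bounded {a} ca with ca 1ℚ 0<1
  ... | N , a≤ = 1ℚ + ∣ a N ∣ , p≤p+q (ℚₚ.0≤∣p∣ (a N)) , N , λ n n≥ →
    subst (λ t → ∣ t ∣ ≤ 1ℚ + ∣ a N ∣)
      (solve 2 (λ x y → (x :- y) :+ y := x) refl (a n) (a N))
      (ℚₚ.≤-trans (ℚₚ.∣p+q∣≤∣p∣+∣q∣ (a n - a N) (a N))
        (ℚₚ.+-monoˡ-≤ ∣ a N ∣ (a≤ n N n≥ ℕₚ.≤-refl)))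

  *-difference : ∀ {A B} x y z w → ∣ x ∣ ≤ A → ∣ w ∣ ≤ B →
                 ∣ x * z - y * w ∣ ≤ A * ∣ z - w ∣ + B * ∣ x - y ∣
  *-difference {A} {B} x y z w x≤A w≤B = begin
    ∣ x * z - y * w ∣
      ≡⟨ cong ∣_∣ (solve 4 (λ x y z w → x :* z :- y :* w := x :* (z :- w) :+ w :* (x :- y)) refl x y z w) ⟩
    ∣ x * (z - w) + w * (x - y) ∣
      ≤⟨ ℚₚ.∣p+q∣≤∣p∣+∣q∣ (x * (z - w)) (w * (x - y)) ⟩
    ∣ x * (z - w) ∣ + ∣ w * (x - y) ∣
      ≡⟨ cong₂ _+_ (ℚₚ.∣p*q∣≡∣p∣*∣q∣ x (z - w)) (ℚₚ.∣p*q∣≡∣p∣*∣q∣ w (x - y)) ⟩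
    ∣ x ∣ * ∣ z - w ∣ + ∣ w ∣ * ∣ x - y ∣
      ≤⟨ ℚₚ.+-mono-≤ (*-monoʳ (ℚₚ.0≤∣p∣ (z - w)) x≤A) (*-monoʳ (ℚₚ.0≤∣p∣ (x - y)) w≤B) ⟩
    A * ∣ z - w ∣ + B * ∣ x - y ∣ ∎
    where open ℚₚ.≤-Reasoning

  *-cauchy : ∀ {a b} → IsCauchy a → IsCauchy b → IsCauchy (λ n → a n * b n)
  *-cauchy {a} {b} ca cb = go (bounded {a} ca) (bounded {b} cb)
    where
    go : (∃ λ A → 1ℚ ≤ A × ∃ λ M → ∀ n → M ℕ.≤ n → ∣ a n ∣ ≤ A) →
         (∃ λ B → 1ℚ ≤ B × ∃ λ N → ∀ n → N ℕ.≤ n → ∣ b n ∣ ≤ B) →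
         IsCauchy (λ n → a n * b n)
    go (A , 1≤A , M , a≤A) (B , 1≤B , N , b≤B) = small-mono (M ℕ.⊔ N)
      (λ m n m≥ n≥ → *-difference (a m) (a n) (b m) (b n)
        (a≤A m (⊔ˡ m≥)) (b≤B n (⊔ʳ {M} n≥)))
      (small-+ (small-* A (ℚₚ.<-≤-trans 0<1 1≤A) cb)
               (small-* B (ℚₚ.<-≤-trans 0<1 1≤B) ca))

  ⊔-nonexpansive : ∀ δ p q → ∣ (δ ⊔ p) - (δ ⊔ q) ∣ ≤ ∣ p - q ∣
  ⊔-nonexpansive δ p q = ∣p∣≤ (go p q)
    (subst₂ _≤_ (solve 2 (λ x y → y :- x := :- (x :- y)) refl (δ ⊔ p) (δ ⊔ q))
      (∣-∣-sym q p) (go q p))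
    where
    go : ∀ p q → (δ ⊔ p) - (δ ⊔ q) ≤ ∣ p - q ∣
    go p q = subst ((δ ⊔ p) - (δ ⊔ q) ≤_)
      (solve 2 (λ x y → (x :+ y) :- y := x) refl ∣ p - q ∣ (δ ⊔ q))
      (ℚₚ.+-monoˡ-≤ (- (δ ⊔ q)) (ℚₚ.⊔-lub
        (ℚₚ.≤-trans (ℚₚ.p≤p⊔q δ q) (q≤p+q (ℚₚ.0≤∣p∣ (p - q))))
        (ℚₚ.≤-trans
          (ℚₚ.≤-reflexive (solve 2 (λ x y → x := (x :- y) :+ y) refl p q))
          (ℚₚ.+-mono-≤ (p≤∣p∣ (p - q)) (ℚₚ.p≤q⊔p δ q)))))

  module _ (δ : ℚ) (0<δ : 0ℚ < δ) where

    private
      c = clampedInverse δ 0<δ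

    0<δ⊔ : ∀ q → 0ℚ < δ ⊔ q
    0<δ⊔ q = ℚₚ.<-≤-trans 0<δ (ℚₚ.p≤p⊔q δ q)

    clamped-inverseˡ : ∀ q → c q * (δ ⊔ q) ≡ 1ℚ
    clamped-inverseˡ q = ℚₚ.*-inverseˡ (δ ⊔ q) {{ℚ.>-nonZero (0<δ⊔ q)}}

    0<clamped : ∀ q → 0ℚ < c q
    0<clamped q = inverse-pos (0<δ⊔ q)

    clamped-*δ : ∀ q → c q * δ ≤ 1ℚ
    clamped-*δ q = subst (c q * δ ≤_) (clamped-inverseˡ q)
      (*-monoˡ (ℚₚ.<⇒≤ (0<clamped q)) (ℚₚ.p≤p⊔q δ q))

    private
      D = ℚ.1/_ δ {{ℚ.>-nonZero 0<δ}}

      0<D : 0ℚ < D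
      0<D = inverse-pos 0<δ

    clamped≤ : ∀ q → c q ≤ D
    clamped≤ q = subst₂ _≤_
      (trans (ℚₚ.*-assoc (c q) δ D)
        (trans (cong (c q *_) (ℚₚ.*-inverseʳ δ {{ℚ.>-nonZero 0<δ}}))
          (ℚₚ.*-identityʳ (c q))))
      (ℚₚ.*-identityˡ D)
      (*-monoʳ (ℚₚ.<⇒≤ 0<D) (clamped-*δ q))

    clamped-cauchy : ∀ {a} → IsCauchy a → IsCauchy (λ n → c (a n))
    clamped-cauchy {a} ca = small-mono 0
      (λ m n _ _ → begin
        ∣ c (a m) - c (a n) ∣
          ≡⟨ cong ∣_∣ (difference (a m) (a n)) ⟩
        ∣ (c (a m) * c (a n)) * ((δ ⊔ a n) - (δ ⊔ a m)) ∣
          ≡⟨ ℚₚ.∣p*q∣≡∣p∣*∣q∣ (c (a m) * c (a n)) ((δ ⊔ a n) - (δ ⊔ a m)) ⟩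
        ∣ c (a m) * c (a n) ∣ * ∣ (δ ⊔ a n) - (δ ⊔ a m) ∣
          ≡⟨ cong₂ _*_ (ℚₚ.0≤p⇒∣p∣≡p (nonNeg-* (0≤c (a m)) (0≤c (a n))))
                       (∣-∣-sym (δ ⊔ a n) (δ ⊔ a m)) ⟩
        (c (a m) * c (a n)) * ∣ (δ ⊔ a m) - (δ ⊔ a n) ∣
          ≤⟨ *-mono (nonNeg-* (0≤c (a m)) (0≤c (a n))) (ℚₚ.0≤∣p∣ (a m - a n))
               (*-mono (0≤c (a m)) (ℚₚ.<⇒≤ 0<D) (clamped≤ (a m)) (clamped≤ (a n)))
               (⊔-nonexpansive δ (a m) (a n)) ⟩
        (D * D) * ∣ a m - a n ∣ ∎)
      (small-* (D * D) (pos-* 0<D 0<D) ca)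
      where
      open ℚₚ.≤-Reasoning
      0≤c : ∀ q → 0ℚ ≤ c q
      0≤c q = ℚₚ.<⇒≤ (0<clamped q)
      difference : ∀ p q → c p - c q ≡ (c p * c q) * ((δ ⊔ q) - (δ ⊔ p))
      difference p q = trans
        (cong₂ _-_ (sym (ℚₚ.*-identityʳ (c p))) (sym (ℚₚ.*-identityʳ (c q))))
        (trans
          (cong₂ (λ s t → c p * s - c q * t) (sym (clamped-inverseˡ q)) (sym (clamped-inverseˡ p)))
          (solve 4 (λ x y z w → x :* (y :* w) :- y :* (x :* z) := (x :* y) :* (w :- z)) refl
            (c p) (c q) (δ ⊔ p) (δ ⊔ q)))

  ∑<-dominated : ∀ {a b} n → (∀ k → n ℕ.≤ k → ∣ a k ∣ ≤ b k) → ∀ m → n ℕ.≤ m →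
                 ∣ ∑< m a - ∑< n a ∣ ≤ ∑< m b - ∑< n b
  ∑<-dominated {a} {b} n a≤b m n≤m = go (ℕₚ.≤⇒≤′ n≤m)
    where
    open ℚₚ.≤-Reasoning
    go : ∀ {m} → n ℕ.≤′ m → ∣ ∑< m a - ∑< n a ∣ ≤ ∑< m b - ∑< n b
    go ℕ.≤′-refl = ℚₚ.≤-reflexive (trans (cong ∣_∣ (ℚₚ.+-inverseʳ (∑< n a)))
                                         (sym (ℚₚ.+-inverseʳ (∑< n b))))
    go (ℕ.≤′-step {m} n≤′m) = begin
      ∣ (∑< m a + a m) - ∑< n a ∣
        ≡⟨ cong ∣_∣ (solve 3 (λ x y z → (x :+ y) :- z := (x :- z) :+ y) refl
             (∑< m a) (a m) (∑< n a)) ⟩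
      ∣ (∑< m a - ∑< n a) + a m ∣
        ≤⟨ ℚₚ.∣p+q∣≤∣p∣+∣q∣ (∑< m a - ∑< n a) (a m) ⟩
      ∣ ∑< m a - ∑< n a ∣ + ∣ a m ∣
        ≤⟨ ℚₚ.+-mono-≤ (go n≤′m) (a≤b m (ℕₚ.≤′⇒≤ n≤′m)) ⟩
      (∑< m b - ∑< n b) + b m
        ≡⟨ solve 3 (λ x y z → (x :- z) :+ y := (x :+ y) :- z) refl
             (∑< m b) (b m) (∑< n b) ⟩
      (∑< m b + b m) - ∑< n b ∎

  recip-difference : ∀ k → recip (suc k) - recip (2 ℕ.+ k) ≡ recip (suc k) * recip (2 ℕ.+ k)
  recip-difference k = begin
    p - q
      ≡⟨ cong₂ _-_ (sym (ℚₚ.*-identityʳ p)) (sym (ℚₚ.*-identityʳ q)) ⟩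
    p * 1ℚ - q * 1ℚ
      ≡⟨ cong₂ (λ s t → p * s - q * t) (sym (recip-inverse (suc k))) (sym (recip-inverse k)) ⟩
    p * (q * (1ℚ + K)) - q * (p * K)
      ≡⟨ solve 3 (λ p q K → p :* (q :* (con 1ℚ :+ K)) :- q :* (p :* K) := p :* q) refl p q K ⟩
    p * q ∎
    where
    open ≡-Reasoning
    p = recip (suc k)
    q = recip (2 ℕ.+ k)
    K = fromNat (suc k)

  ζ-partialSum : ℕ → ℕ → ℚ
  ζ-partialSum s n = ∑< n (ζ-term s)

  0≤ζ-term : ∀ s k → 0ℚ ≤ ζ-term s k
  0≤ζ-term s k = 0≤recip (suc k ℕ.^ s) {{ℕₚ.m^n≢0 (suc k) s}}

  ζ-term-bound : ∀ s → 2 ℕ.≤ s → ∀ k →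
                 ζ-term s (suc k) ≤ recip (suc k) - recip (2 ℕ.+ k)
  ζ-term-bound s 2≤s k = begin
    ζ-term s (suc k)
      ≤⟨ recip-antimono (suc K ℕ.* suc K) (suc K ℕ.^ s) {{_}} {{ℕₚ.m^n≢0 (suc K) s}}
           (subst (ℕ._≤ suc K ℕ.^ s) (cong (suc K ℕ.*_) (ℕₚ.*-identityʳ (suc K)))
             (ℕₚ.^-monoʳ-≤ (suc K) 2≤s)) ⟩
    recip (suc K ℕ.* suc K)
      ≡⟨ recip-* K K ⟩
    recip (suc K) * recip (suc K)
      ≤⟨ *-monoʳ (0≤recip (suc K)) (recip-antimono (suc k) (suc K) (ℕₚ.n≤1+n (suc k))) ⟩
    recip (suc k) * recip (suc K)
      ≡⟨ recip-difference k ⟨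
    recip (suc k) - recip (suc K) ∎
    where
    open ℚₚ.≤-Reasoning
    K = suc k

  module _ (S e : ℕ → ℚ) (0≤e : ∀ n → 0ℚ ≤ e n)
           (S≤e : ∀ m n → n ℕ.≤ m → ∣ S m - S n ∣ ≤ e n) where

    tail-bound : ∀ m n → ∣ S m - S n ∣ ≤ e m + e n
    tail-bound m n with ℕₚ.≤-total n m
    ... | inj₁ n≤m = ℚₚ.≤-trans (S≤e m n n≤m) (q≤p+q (0≤e m))
    ... | inj₂ m≤n = ℚₚ.≤-trans (ℚₚ.≤-reflexive (∣-∣-sym (S m) (S n)))
                       (ℚₚ.≤-trans (S≤e n m m≤n) (p≤p+q (0≤e n)))

  ζ-cauchy : ∀ s → 2 ℕ.≤ s → IsCauchy (ζ-partialSum s)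
  ζ-cauchy s 2≤s = small-mono 1 bound (small-+ small-recipˡ small-recipʳ)
    where
    b : ℕ → ℚ
    b zero    = 0ℚ
    b (suc k) = recip (suc k) - recip (2 ℕ.+ k)

    telescope : ∀ n → ∑< (suc n) b ≡ 1ℚ - recip (suc n)
    telescope zero    = refl
    telescope (suc n) = trans (cong (_+ b (suc n)) (telescope n))
      (solve 3 (λ o x y → (o :- x) :+ (x :- y) := o :- y) refl
        1ℚ (recip (suc n)) (recip (2 ℕ.+ n)))

    dominated : ∀ n k → suc n ℕ.≤ k → ∣ ζ-term s k ∣ ≤ b k
    dominated n (suc k) _ = subst (_≤ b (suc k))
      (sym (ℚₚ.0≤p⇒∣p∣≡p (0≤ζ-term s (suc k)))) (ζ-term-bound s 2≤s k)

    tail : ∀ m n → n ℕ.≤ m →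
           ∣ ζ-partialSum s (suc m) - ζ-partialSum s (suc n) ∣ ≤ recip (suc n)
    tail m n n≤m = begin
      ∣ ζ-partialSum s (suc m) - ζ-partialSum s (suc n) ∣
        ≤⟨ ∑<-dominated (suc n) (dominated n) (suc m) (s≤s n≤m) ⟩
      ∑< (suc m) b - ∑< (suc n) b
        ≡⟨ cong₂ _-_ (telescope m) (telescope n) ⟩
      (1ℚ - recip (suc m)) - (1ℚ - recip (suc n))
        ≡⟨ solve 3 (λ o x y → (o :- x) :- (o :- y) := y :- x) refl
             1ℚ (recip (suc m)) (recip (suc n)) ⟩
      recip (suc n) - recip (suc m)
        ≤⟨ ℚₚ.+-monoʳ-≤ (recip (suc n)) (ℚₚ.neg-antimono-≤ (0≤recip (suc m))) ⟩
      recip (suc n) - 0ℚ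
        ≡⟨ ℚₚ.+-identityʳ (recip (suc n)) ⟩
      recip (suc n) ∎
      where open ℚₚ.≤-Reasoning

    bound : ∀ m n → 1 ℕ.≤ m → 1 ℕ.≤ n → ∣ ζ-partialSum s m - ζ-partialSum s n ∣ ≤
            recip (suc (ℕ.pred m)) + recip (suc (ℕ.pred n))
    bound (suc m) (suc n) _ _ = tail-bound (λ k → ζ-partialSum s (suc k))
      (λ k → recip (suc k)) (λ k → 0≤recip (suc k)) tail m n

  1≤ζ-partialSum : ∀ s n → 1 ℕ.≤ n → 1ℚ ≤ ζ-partialSum s n
  1≤ζ-partialSum s (suc zero)    _ = ℚₚ.≤-reflexive
    (sym (trans (ℚₚ.+-identityˡ (ζ-term s 0)) (ζ-term-0 s)))
    where
    ζ-term-0 : ∀ s → ζ-term s 0 ≡ 1ℚ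
    ζ-term-0 s = ℚₚ./-cong {+ 1} {1 ℕ.^ s} {+ 1} {1} {{ℕₚ.m^n≢0 1 s}} refl (ℕₚ.^-zeroˡ s)
  1≤ζ-partialSum s (suc (suc n)) _ = ℚₚ.≤-trans (1≤ζ-partialSum s (suc n) (s≤s z≤n))
    (p≤p+q (0≤ζ-term s (suc n)))

  module _ (r B : ℚ) (0≤r : 0ℚ ≤ r) (r≤1 : r ≤ 1ℚ) (0≤B : 0ℚ ≤ B)
           (1≤[1-r]B : 1ℚ ≤ (1ℚ - r) * B) where

    private
      g : ℕ → ℚ
      g n = ∑< n (λ k → r ^ k)

      0≤^ : ∀ {u} → 0ℚ ≤ u → ∀ k → 0ℚ ≤ u ^ k
      0≤^ 0≤u zero    = 0≤1
      0≤^ 0≤u (suc k) = nonNeg-* 0≤u (0≤^ 0≤u k)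

      ^-mono : ∀ {u v} → 0ℚ ≤ u → u ≤ v → ∀ k → u ^ k ≤ v ^ k
      ^-mono 0≤u u≤v zero    = ℚₚ.≤-refl
      ^-mono 0≤u u≤v (suc k) =
        *-mono 0≤u (0≤^ (ℚₚ.≤-trans 0≤u u≤v) k) u≤v (^-mono 0≤u u≤v k)

      0≤g : ∀ n → 0ℚ ≤ g n
      0≤g zero    = ℚₚ.≤-refl
      0≤g (suc n) = ℚₚ.≤-trans (0≤g n) (p≤p+q (0≤^ 0≤r n))

      geometric : ∀ n → g n * (1ℚ - r) + r ^ n ≡ 1ℚ
      geometric zero    = solve 1 (λ r → con 0ℚ :* (con 1ℚ :- r) :+ con 1ℚ := con 1ℚ) refl r
      geometric (suc n) = trans
        (solve 3 (λ G p r → (G :+ p) :* (con 1ℚ :- r) :+ r :* p := G :* (con 1ℚ :- r) :+ p) refl (g n) (r ^ n) r)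
        (geometric n)

      g≤B : ∀ n → g n ≤ B
      g≤B n = begin
        g n                     ≡⟨ ℚₚ.*-identityʳ (g n) ⟨
        g n * 1ℚ                ≤⟨ *-monoˡ (0≤g n) 1≤[1-r]B ⟩
        g n * ((1ℚ - r) * B)    ≡⟨ ℚₚ.*-assoc (g n) (1ℚ - r) B ⟨
        (g n * (1ℚ - r)) * B    ≤⟨ *-monoʳ {B} {g n * (1ℚ - r)} 0≤B (p≤p+q (0≤^ 0≤r n)) ⟩
        (g n * (1ℚ - r) + r ^ n) * B ≡⟨ cong (_* B) (geometric n) ⟩
        1ℚ * B                  ≡⟨ ℚₚ.*-identityˡ B ⟩
        B ∎
        where open ℚₚ.≤-Reasoning

      ∑<-*ˡ : ∀ c a n → ∑< n (λ k → c * a k) ≡ c * ∑< n a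
      ∑<-*ˡ c a zero    = sym (ℚₚ.*-zeroʳ c)
      ∑<-*ˡ c a (suc n) = trans (cong (_+ c * a n) (∑<-*ˡ c a n))
                                (sym (ℚₚ.*-distribˡ-+ c (∑< n a) (a n)))

      ∑<-- : ∀ a b n → ∑< n (λ k → a k - b k) ≡ ∑< n a - ∑< n b
      ∑<-- a b zero    = refl
      ∑<-- a b (suc n) = trans (cong (_+ (a n - b n)) (∑<-- a b n))
        (solve 4 (λ x y z w → (x :- y) :+ (z :- w) := (x :+ z) :- (y :+ w)) refl
          (∑< n a) (∑< n b) (a n) (b n))

    log-tail : ∀ v → 0ℚ ≤ v → v ≤ r → ∀ m n → n ℕ.≤ m →
               ∣ logPartialSum v m - logPartialSum v n ∣ ≤ B * recip (suc n)
    log-tail v 0≤v v≤r m n n≤m = begin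
      ∣ logPartialSum v m - logPartialSum v n ∣
        ≤⟨ ∑<-dominated n dominated m n≤m ⟩
      ∑< m (λ k → ρ * r ^ k) - ∑< n (λ k → ρ * r ^ k)
        ≡⟨ cong₂ _-_ (∑<-*ˡ ρ (r ^_) m) (∑<-*ˡ ρ (r ^_) n) ⟩
      ρ * g m - ρ * g n
        ≤⟨ ℚₚ.+-mono-≤ (*-monoˡ 0≤ρ (g≤B m))
             (ℚₚ.neg-antimono-≤ (nonNeg-* 0≤ρ (0≤g n))) ⟩
      ρ * B - 0ℚ
        ≡⟨ ℚₚ.+-identityʳ (ρ * B) ⟩
      ρ * B
        ≡⟨ ℚₚ.*-comm ρ B ⟩
      B * ρ ∎
      where
      open ℚₚ.≤-Reasoning
      ρ = recip (suc n)
      0≤ρ = 0≤recip (suc n)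
      dominated : ∀ k → n ℕ.≤ k → ∣ v ^ suc k * recip (suc k) ∣ ≤ ρ * r ^ k
      dominated k n≤k = begin
        ∣ v ^ suc k * recip (suc k) ∣
          ≡⟨ ℚₚ.0≤p⇒∣p∣≡p (nonNeg-* (0≤^ 0≤v (suc k)) (0≤recip (suc k))) ⟩
        v ^ suc k * recip (suc k)
          ≤⟨ *-mono (0≤^ 0≤v (suc k)) 0≤ρ
               (ℚₚ.≤-trans (^-mono 0≤v v≤r (suc k))
                 (subst (r ^ suc k ≤_) (ℚₚ.*-identityˡ (r ^ k))
                   (*-monoʳ (0≤^ 0≤r k) r≤1)))
               (recip-antimono (suc n) (suc k) (s≤s n≤k)) ⟩
        r ^ k * ρ
          ≡⟨ ℚₚ.*-comm (r ^ k) ρ ⟩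
        ρ * r ^ k ∎

    private
      power-lipschitz : ∀ u v → 0ℚ ≤ u → u ≤ r → 0ℚ ≤ v → v ≤ r → ∀ k →
        ∣ u ^ suc k - v ^ suc k ∣ ≤ fromNat (suc k) * (∣ u - v ∣ * r ^ k)
      power-lipschitz u v 0≤u u≤r 0≤v v≤r zero = ℚₚ.≤-reflexive
        (trans (cong ∣_∣ (solve 2 (λ u v → u :* con 1ℚ :- v :* con 1ℚ := u :- v) refl u v))
          (solve 1 (λ d → d := (con 1ℚ :+ con 0ℚ) :* (d :* con 1ℚ)) refl ∣ u - v ∣))
      power-lipschitz u v 0≤u u≤r 0≤v v≤r (suc k) = begin
        ∣ u * U - v * V ∣
          ≡⟨ cong ∣_∣ (solve 4 (λ u v U V → u :* U :- v :* V := u :* (U :- V) :+ (u :- v) :* V) refl u v U V) ⟩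
        ∣ u * (U - V) + (u - v) * V ∣
          ≤⟨ ℚₚ.∣p+q∣≤∣p∣+∣q∣ (u * (U - V)) ((u - v) * V) ⟩
        ∣ u * (U - V) ∣ + ∣ (u - v) * V ∣
          ≡⟨ cong₂ _+_
               (trans (ℚₚ.∣p*q∣≡∣p∣*∣q∣ u (U - V)) (cong (_* ∣ U - V ∣) (ℚₚ.0≤p⇒∣p∣≡p 0≤u)))
               (trans (ℚₚ.∣p*q∣≡∣p∣*∣q∣ (u - v) V)
                 (cong (∣ u - v ∣ *_) (ℚₚ.0≤p⇒∣p∣≡p (0≤^ 0≤v (suc k))))) ⟩
        u * ∣ U - V ∣ + d * V
          ≤⟨ ℚₚ.+-mono-≤
               (*-mono 0≤u (ℚₚ.≤-trans (ℚₚ.0≤∣p∣ (U - V)) ih) u≤r ih)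
               (*-monoˡ (ℚₚ.0≤∣p∣ (u - v)) (^-mono 0≤v v≤r (suc k))) ⟩
        r * (F * (d * r ^ k)) + d * r ^ suc k
          ≡⟨ solve 4 (λ r F d p → r :* (F :* (d :* p)) :+ d :* (r :* p) := (con 1ℚ :+ F) :* (d :* (r :* p))) refl r F d (r ^ k) ⟩
        fromNat (2 ℕ.+ k) * (d * r ^ suc k) ∎
        where
        open ℚₚ.≤-Reasoning
        U = u ^ suc k
        V = v ^ suc k
        d = ∣ u - v ∣
        F = fromNat (suc k)
        ih = power-lipschitz u v 0≤u u≤r 0≤v v≤r k

    log-lipschitz : ∀ u v → 0ℚ ≤ u → u ≤ r → 0ℚ ≤ v → v ≤ r → ∀ n →
      ∣ logPartialSum u n - logPartialSum v n ∣ ≤ B * ∣ u - v ∣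
    log-lipschitz u v 0≤u u≤r 0≤v v≤r n = begin
      ∣ logPartialSum u n - logPartialSum v n ∣
        ≡⟨ cong ∣_∣ (∑<-- (λ k → u ^ suc k * recip (suc k)) (λ k → v ^ suc k * recip (suc k)) n) ⟨
      ∣ ∑< n w ∣
        ≡⟨ cong ∣_∣ (ℚₚ.+-identityʳ (∑< n w)) ⟨
      ∣ ∑< n w - 0ℚ ∣
        ≤⟨ ∑<-dominated 0 (λ k _ → dominated k) n z≤n ⟩
      ∑< n (λ k → d * r ^ k) - 0ℚ
        ≡⟨ trans (ℚₚ.+-identityʳ _) (∑<-*ˡ d (r ^_) n) ⟩
      d * g n
        ≤⟨ *-monoˡ (ℚₚ.0≤∣p∣ (u - v)) (g≤B n) ⟩
      d * B
        ≡⟨ ℚₚ.*-comm d B ⟩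
      B * d ∎
      where
      open ℚₚ.≤-Reasoning
      d = ∣ u - v ∣
      w : ℕ → ℚ
      w k = u ^ suc k * recip (suc k) - v ^ suc k * recip (suc k)
      dominated : ∀ k → ∣ w k ∣ ≤ d * r ^ k
      dominated k = begin
        ∣ w k ∣
          ≡⟨ cong ∣_∣ (solve 3 (λ x y z → x :* z :- y :* z := z :* (x :- y)) refl
               (u ^ suc k) (v ^ suc k) (recip (suc k))) ⟩
        ∣ recip (suc k) * (u ^ suc k - v ^ suc k) ∣
          ≡⟨ trans (ℚₚ.∣p*q∣≡∣p∣*∣q∣ (recip (suc k)) (u ^ suc k - v ^ suc k))
               (cong (_* ∣ u ^ suc k - v ^ suc k ∣) (ℚₚ.0≤p⇒∣p∣≡p (0≤recip (suc k)))) ⟩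
        recip (suc k) * ∣ u ^ suc k - v ^ suc k ∣
          ≤⟨ *-monoˡ (0≤recip (suc k)) (power-lipschitz u v 0≤u u≤r 0≤v v≤r k) ⟩
        recip (suc k) * (fromNat (suc k) * (d * r ^ k))
          ≡⟨ ℚₚ.*-assoc (recip (suc k)) (fromNat (suc k)) (d * r ^ k) ⟨
        (recip (suc k) * fromNat (suc k)) * (d * r ^ k)
          ≡⟨ cong (_* (d * r ^ k)) (recip-inverse k) ⟩
        1ℚ * (d * r ^ k)
          ≡⟨ ℚₚ.*-identityˡ (d * r ^ k) ⟩
        d * r ^ k ∎

  logArgument : ℚ → ℚ
  logArgument q = 1ℚ - clampedInverse 1ℚ 0<1 q

  0≤logArgument : ∀ q → 0ℚ ≤ logArgument q
  0≤logArgument q = ≤⇒0≤- (subst (_≤ 1ℚ) (ℚₚ.*-identityʳ (clampedInverse 1ℚ 0<1 q)) (clamped-*δ 1ℚ 0<1 q))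

  private
    log-cauchy′ : ∀ {a} → IsCauchy a → ∀ B → 1ℚ ≤ B → ∀ N →
                  (∀ n → N ℕ.≤ n → ∣ a n ∣ ≤ B) →
                  IsCauchy (λ n → logPartialSum (logArgument (a n)) n)
    log-cauchy′ {a} ca B 1≤B N a≤B = small-mono
      {e = λ m n → B * ∣ u m - u n ∣ +
             (B * recip (suc (ℕ.pred m)) + B * recip (suc (ℕ.pred n)))} N
      (λ m n m≥ n≥ → begin
        ∣ L (u m) m - L (u n) n ∣
          ≡⟨ cong ∣_∣ (solve 3 (λ x y z → x :- z := (x :- y) :+ (y :- z)) refl
               (L (u m) m) (L (u n) m) (L (u n) n)) ⟩
        ∣ (L (u m) m - L (u n) m) + (L (u n) m - L (u n) n) ∣
          ≤⟨ ℚₚ.∣p+q∣≤∣p∣+∣q∣ (L (u m) m - L (u n) m) (L (u n) m - L (u n) n) ⟩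
        ∣ L (u m) m - L (u n) m ∣ + ∣ L (u n) m - L (u n) n ∣
          ≤⟨ ℚₚ.+-mono-≤
               (log-lipschitz r B 0≤r r≤1 0≤B 1≤[1-r]B (u m) (u n)
                 (0≤logArgument (a m)) (u≤r m m≥)
                 (0≤logArgument (a n)) (u≤r n n≥) m)
               (tail-bound (L (u n)) (λ k → B * recip (suc k))
                 (λ k → nonNeg-* 0≤B (0≤recip (suc k)))
                 (log-tail r B 0≤r r≤1 0≤B 1≤[1-r]B (u n)
                   (0≤logArgument (a n)) (u≤r n n≥)) m n) ⟩
        B * ∣ u m - u n ∣ + (B * recip (suc m) + B * recip (suc n))
          ≤⟨ ℚₚ.+-monoʳ-≤ (B * ∣ u m - u n ∣) (ℚₚ.+-mono-≤
               (*-monoˡ 0≤B (recip-pred m)) (*-monoˡ 0≤B (recip-pred n))) ⟩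
        B * ∣ u m - u n ∣ + (B * recip (suc (ℕ.pred m)) + B * recip (suc (ℕ.pred n))) ∎)
      (small-+ (small-* {λ m n → ∣ u m - u n ∣} B 0<B u-cauchy)
               (small-+ (small-* B 0<B small-recipˡ) (small-* B 0<B small-recipʳ)))
      where
      open ℚₚ.≤-Reasoning
      L = logPartialSum
      u : ℕ → ℚ
      u n = logArgument (a n)
      u-cauchy : IsCauchy u
      u-cauchy = +-cauchy {λ _ → 1ℚ} {λ n → - clampedInverse 1ℚ 0<1 (a n)}
        (const-cauchy 1ℚ) (neg-cauchy {λ n → clampedInverse 1ℚ 0<1 (a n)}
          (clamped-cauchy 1ℚ 0<1 {a} ca))
      0<B = ℚₚ.<-≤-trans 0<1 1≤B
      0≤B = ℚₚ.<⇒≤ 0<B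
      1/B = ℚ.1/_ B {{ℚ.>-nonZero 0<B}}
      1/B*B : 1/B * B ≡ 1ℚ
      1/B*B = ℚₚ.*-inverseˡ B {{ℚ.>-nonZero 0<B}}
      0≤1/B = ℚₚ.<⇒≤ (inverse-pos 0<B)
      r = 1ℚ - 1/B
      0≤r : 0ℚ ≤ r
      0≤r = ≤⇒0≤- (subst₂ _≤_ (ℚₚ.*-identityʳ 1/B) 1/B*B (*-monoˡ 0≤1/B 1≤B))
      r≤1 : r ≤ 1ℚ
      r≤1 = subst (r ≤_) (ℚₚ.+-identityʳ 1ℚ) (ℚₚ.+-monoʳ-≤ 1ℚ (ℚₚ.neg-antimono-≤ 0≤1/B))
      1≤[1-r]B : 1ℚ ≤ (1ℚ - r) * B
      1≤[1-r]B = ℚₚ.≤-reflexive (trans (sym 1/B*B)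
        (cong (_* B) (solve 2 (λ o x → x := o :- (o :- x)) refl 1ℚ 1/B)))
      u≤r : ∀ n → N ℕ.≤ n → u n ≤ r
      u≤r n n≥ = ℚₚ.+-monoʳ-≤ 1ℚ (ℚₚ.neg-antimono-≤ 1/B≤c)
        where
        c = clampedInverse 1ℚ 0<1 (a n)
        1/B≤c : 1/B ≤ c
        1/B≤c = begin
          1/B                      ≡⟨ ℚₚ.*-identityˡ 1/B ⟨
          1ℚ * 1/B                 ≡⟨ cong (_* 1/B) (clamped-inverseˡ 1ℚ 0<1 (a n)) ⟨
          (c * (1ℚ ⊔ a n)) * 1/B   ≤⟨ *-monoʳ 0≤1/B (*-monoˡ (ℚₚ.<⇒≤ (0<clamped 1ℚ 0<1 (a n)))
                                        (ℚₚ.⊔-lub 1≤B (ℚₚ.≤-trans (p≤∣p∣ (a n)) (a≤B n n≥)))) ⟩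
          (c * B) * 1/B            ≡⟨ ℚₚ.*-assoc c B 1/B ⟩
          c * (B * 1/B)            ≡⟨ cong (c *_) (trans (ℚₚ.*-comm B 1/B) 1/B*B) ⟩
          c * 1ℚ                   ≡⟨ ℚₚ.*-identityʳ c ⟩
          c ∎
      recip-pred : ∀ m → recip (suc m) ≤ recip (suc (ℕ.pred m))
      recip-pred m = recip-antimono (suc (ℕ.pred m)) (suc m) (s≤s (ℕₚ.pred[n]≤n {m}))

  log-cauchy : ∀ {a} → IsCauchy a → IsCauchy (λ n → logPartialSum (logArgument (a n)) n)
  log-cauchy {a} ca = let B , 1≤B , N , a≤B = bounded {a} ca in log-cauchy′ {a} ca B 1≤B N a≤B

record ℝ : Set where
  constructor mkℝ
  field
    seq    : ℕ → ℚ
    cauchy : IsCauchy seq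

open ℝ public

infix  8 -_
infixl 7 _*_
infixl 6 _+_ _-_
infix  4 _≤_ _<_

_≤_ : ℝ → ℝ → Set
x ≤ y = ∀ ε → 0ℚ ℚ.< ε → ∃ λ N → ∀ n → N ℕ.≤ n → seq x n ℚ.≤ seq y n ℚ.+ ε

_<_ : ℝ → ℝ → Set
x < y = ∃ λ ε → 0ℚ ℚ.< ε × ∃ λ N → ∀ n → N ℕ.≤ n → seq x n ℚ.+ ε ℚ.≤ seq y n

fromℚ : ℚ → ℝ
fromℚ q = mkℝ (λ _ → q) (CauchyFacts.const-cauchy q)

fromℕ : ℕ → ℝ
fromℕ n = fromℚ (+ n ℚ./ 1)

_+_ : ℝ → ℝ → ℝ
x + y = mkℝ (λ n → seq x n ℚ.+ seq y n) (CauchyFacts.+-cauchy {seq x} {seq y} (cauchy x) (cauchy y))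

-_ : ℝ → ℝ
- x = mkℝ (λ n → ℚ.- seq x n) (CauchyFacts.neg-cauchy {seq x} (cauchy x))

_-_ : ℝ → ℝ → ℝ
x - y = x + - y

_*_ : ℝ → ℝ → ℝ
x * y = mkℝ (λ n → seq x n ℚ.* seq y n) (CauchyFacts.*-cauchy {seq x} {seq y} (cauchy x) (cauchy y))

∣_∣ : ℝ → ℝ
∣ x ∣ = mkℝ (λ n → ℚ.∣ seq x n ∣) (CauchyFacts.abs-cauchy {seq x} (cauchy x))

-- The proof of 0 < y provides ε > 0 with ε ≤ seq y n eventually, so the
-- clamping at ε affects only finitely many terms.
_÷_[_] : (x y : ℝ) → fromℕ 0 < y → ℝ
x ÷ y [ ε , 0<ε , _ ] = x *
  mkℝ (λ n → clampedInverse ε 0<ε (seq y n))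
      (CauchyFacts.clamped-cauchy ε 0<ε {seq y} (cauchy y))

ζ : (s : ℕ) → 2 ℕ.≤ s → ℝ
ζ s 2≤s = mkℝ (λ n → ∑< n (ζ-term s)) (CauchyFacts.ζ-cauchy s 2≤s)

-- The natural logarithm of max(1, x), from the expansion
--   log y = − log (1 − u) = u + u²/2 + u³/3 + ⋯   with u = 1 − 1/y ∈ [0, 1),
-- valid for y ≥ 1. The n-th approximation takes n terms of the series at
-- the n-th approximation of u.
log : ℝ → ℝ
log x = mkℝ (λ n → logPartialSum (CauchyFacts.logArgument (seq x n)) n)
            (CauchyFacts.log-cauchy {seq x} (cauchy x))

-- N is the integer part of x ≥ 0. It is a relation because the integer
-- part is not a computable function of a Cauchy sequence.
IsFloor : ℝ → ℕ → Set
IsFloor x N = fromℕ N ≤ x × x < fromℕ (suc N)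

2≤2b : ∀ b → 2 ℕ.≤ b → 2 ℕ.≤ 2 ℕ.* b
2≤2b b 2≤b = ℕₚ.≤-trans 2≤b (ℕₚ.m≤n*m b 2)

2≤2b∸1 : ∀ b → 2 ℕ.≤ b → 2 ℕ.≤ 2 ℕ.* b ℕ.∸ 1
2≤2b∸1 b 2≤b = ℕₚ.≤-trans (s≤s (s≤s z≤n)) (ℕₚ.∸-monoˡ-≤ 1 (ℕₚ.*-monoʳ-≤ 2 2≤b))

0<2ζ : ∀ s (2≤s : 2 ℕ.≤ s) → fromℕ 0 < fromℕ 2 * ζ s 2≤s
0<2ζ s 2≤s = 1ℚ , 0<1 , 1 , λ n 1≤n → ℚₚ.≤-trans 0+1≤2*1
  (*-monoˡ {+ 2 ℚ./ 1} (ℚ.*≤* (ℤ.+≤+ z≤n)) (1≤ζ-partialSum s n 1≤n))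
  where
  open CauchyFacts
  0+1≤2*1 : 0ℚ ℚ.+ 1ℚ ℚ.≤ (+ 2 ℚ./ 1) ℚ.* 1ℚ
  0+1≤2*1 = ℚ.*≤* (ℤ.+≤+ (s≤s z≤n))

coefficient : (b : ℕ) → 2 ℕ.≤ b → ℝ
coefficient b 2≤b =
  ζ (2 ℕ.* b ℕ.∸ 1) (2≤2b∸1 b 2≤b)
    ÷ fromℕ 2 * ζ (2 ℕ.* b) (2≤2b b 2≤b) [ 0<2ζ (2 ℕ.* b) (2≤2b b 2≤b) ]

-- The bound is only meaningful for b ≥ 2.
E : ℕ → ℝ → ℝ
E 2 x = x * log x
E _ x = x

-- Let S(N) = ∑_{n ≤ N} h_b(n). Sorting the factorizations e f = (j , n)_b by e
-- gives ∑_{e ≤ N} S(⌊N/eᵇ⌋) = ∑_{e ≤ N} e · M (M + 1) / 2 with M = ⌊N/eᵇ⌋. Hence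
-- f(N) = 2 ζ(2b) S(N) − ζ(2b−1) N² satisfies ∑_{e ≤ N} f(⌊N/eᵇ⌋) = O(N W(N)) with
-- W(N) = ∑_{e ≤ N} e^{1−b}. No Möbius inversion is needed to isolate f(N): since
-- ∑_{e ≥ 2} e^{−b} ≤ 3/4 < 1, the bound f(N) = O(N W(N)) follows by strong induction.
-- The zeta values enter through their n-th partial sums with n ≥ N. Finally W is
-- bounded for b ≥ 3, and for b = 2 it is the harmonic sum, which the series for
-- log x dominates by Bernoulli's inequality.
module Submission where

open import Defs hiding (_+_; _-_; _*_; -_; ∣_∣; _≤_; _<_)
import Data.Integer.Base as ℤ
open import Data.List.Base using (applyUpTo; map; _++_; _∷_; [])
open import Data.List.Properties using (applyUpTo-∷ʳ; map-++)
open import Data.Nat.Base as ℕ using (ℕ; zero; suc; z≤n; s≤s) hiding (module ℕ)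
open import Data.Nat.Coprimality using (Coprime; coprime-/gcd; coprime-divisor) renaming (sym to coprime-sym)
open import Data.Nat.Divisibility
open import Data.Nat.DivMod
  using (m/n*n≡m; m≡m%n+[m/n]*n; m%n<n; m/n≤m; m/n*n≤m; m/n<m; n/1≡n; /-congʳ)
open import Data.Nat.GCD using (gcd; gcd[m,n]∣m; gcd[m,n]∣n; gcd[m,n]≢0)
open import Data.Nat.Induction using (<-rec)
import Data.Nat.ListAction as ListAction
open import Data.Nat.ListAction.Properties using (sum-++)
import Data.Nat.Properties as ℕₚ
open import Data.Product.Base using (Σ-syntax; _×_; _,_; proj₁; proj₂)
open import Data.Rational.Base as ℚ using (ℚ; 0ℚ; 1ℚ; ½) hiding (module ℚ)
import Data.Rational.Properties as ℚₚ
open import Data.Rational.Solver using (module +-*-Solver)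
open import Data.Rational.Unnormalised.Base using (mkℚᵘ)
import Data.Rational.Unnormalised.Properties as ℚᵘₚ
open import Data.Sum.Base using (inj₁; inj₂)
open import Data.Unit.Base using (tt)
open import Function.Base using (_∘_)
open import Relation.Binary.PropositionalEquality
open import Relation.Nullary using (¬_; Dec; yes; no; contradiction)

-- A real number here is a sequence of rational approximations, from which its floor cannot be
-- computed. All estimates are therefore rational inequalities at one index n, with constants
-- independent of n ≥ N, and only the end passes to the order of the reals. At index n the
-- coefficient is Z₁ / (2 Z₂) with truncated zeta sums, and clearing the denominator leaves an
-- inequality without division. Truncating at n instead of N changes a zeta sum by at most 1/N,
-- hence N² times that sum by at most N, which the error term absorbs. The sums run over all e ≤ N,
-- although ⌊N/eᵇ⌋ = 0 once eᵇ > N: this makes the main terms exact zeta partial sums of length N.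
-- Sorting by e needs more than the maximality in the definition of (j , n)_b: every d whose b-th
-- power divides j and n has to divide (j , n)_b itself.

-- Divisibility and scaling of the generalized gcd

module GeneralizedGcd where

  open ℕ using (_*_; _^_; _≤_)

  ^-distribʳ-* : ∀ m n b → (m * n) ^ b ≡ m ^ b * n ^ b
  ^-distribʳ-* m n zero    = refl
  ^-distribʳ-* m n (suc b) = trans (cong (m * n *_) (^-distribʳ-* m n b))
                                   (ℕₚ.[m*n]*[o*p]≡[m*o]*[n*p] m n (m ^ b) (n ^ b))

  ^-monoˡ-∣ : ∀ {m n} b → m ∣ n → m ^ b ∣ n ^ b
  ^-monoˡ-∣ zero    m∣n = ∣-refl
  ^-monoˡ-∣ (suc b) m∣n = *-pres-∣ m∣n (^-monoˡ-∣ b m∣n)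

  coprime-* : ∀ {m n o} → Coprime m n → Coprime m o → Coprime m (n * o)
  coprime-* m⊥n m⊥o (d∣m , d∣no) =
    m⊥o (d∣m , coprime-divisor (λ (c∣d , c∣n) → m⊥n (∣-trans c∣d d∣m , c∣n)) d∣no)

  coprime-^ʳ : ∀ {m n} b → Coprime m n → Coprime m (n ^ b)
  coprime-^ʳ zero    m⊥n (_ , d∣1) = ∣1⇒≡1 d∣1
  coprime-^ʳ (suc b) m⊥n = coprime-* m⊥n (coprime-^ʳ b m⊥n)

  coprime-^ : ∀ {m n} b → Coprime m n → Coprime (m ^ b) (n ^ b)
  coprime-^ b m⊥n = coprime-^ʳ b (coprime-sym (coprime-^ʳ b (coprime-sym m⊥n)))

  coprime⇒*-∣ : ∀ {m n k} → Coprime m n → m ∣ k → n ∣ k → m * n ∣ k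
  coprime⇒*-∣ {m} {n} m⊥n m∣k (divides r refl) =
    *-monoˡ-∣ n (coprime-divisor m⊥n (subst (m ∣_) (ℕₚ.*-comm r n) m∣k))

  -- Since x and y are coprime, x y g is the least common multiple of x g and y g. Cancelling gᵇ
  -- leaves the coprime numbers xᵇ and yᵇ, whose product divides whatever both divide.
  [x*y*g]^b∣ : ∀ {x y} g b {m} .{{_ : ℕ.NonZero g}} → Coprime x y →
               (x * g) ^ b ∣ m → (y * g) ^ b ∣ m → (x * y * g) ^ b ∣ m
  [x*y*g]^b∣ {x} {y} g b {m} x⊥y xg∣m yg∣m
    with subst (_∣ m) (^-distribʳ-* x g b) xg∣m | subst (_∣ m) (^-distribʳ-* y g b) yg∣m
  ... | divides r refl | yg∣m′ = subst₂ _∣_ eq (ℕₚ.*-assoc r (x ^ b) (g ^ b))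
    (*-monoˡ-∣ (g ^ b) (coprime⇒*-∣ (coprime-^ b x⊥y) (n∣m*n r)
      (*-cancelʳ-∣ (g ^ b) (subst (y ^ b * g ^ b ∣_) (sym (ℕₚ.*-assoc r (x ^ b) (g ^ b))) yg∣m′))))
    where
    instance _ = ℕₚ.m^n≢0 g b
    eq : x ^ b * y ^ b * g ^ b ≡ (x * y * g) ^ b
    eq = sym (trans (^-distribʳ-* (x * y) g b) (cong (_* g ^ b) (^-distribʳ-* x y b)))

  -- The least common multiple k of d and g = (j , n)_b still has a b-th power dividing both j and
  -- n, so k ≤ g by maximality. As k is a positive multiple of g, k = g, and d divides it.
  ∣⇒∣gcd[] : ∀ d b j n → 1 ≤ b → 1 ≤ j → 1 ≤ d → d ^ b ∣ j → d ^ b ∣ n → d ∣ gcd[ b ] j n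
  ∣⇒∣gcd[] d b j n 1≤b 1≤j 1≤d dᵇ∣j dᵇ∣n =
    subst (d ∣_) k≡g (subst (_∣ k) x*c≡d (divides y (trans (cong (_* c) (ℕₚ.*-comm x y)) (ℕₚ.*-assoc y x c))))
    where
    g = gcd[ b ] j n
    maximum = gcd[]-isMaximum b j n 1≤b 1≤j
    1≤g = proj₁ maximum
    instance
      _ = ℕ.>-nonZero 1≤j
      _ = ℕ.>-nonZero 1≤d
      _ = ℕ.≢-nonZero (gcd[m,n]≢0 d g (inj₁ (ℕ.≢-nonZero⁻¹ d)))
    c = gcd d g
    x = d ℕ./ c
    y = g ℕ./ c
    k = x * y * c
    x*c≡d : x * c ≡ d
    x*c≡d = m/n*n≡m (gcd[m,n]∣m d g)
    y*c≡g : y * c ≡ g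
    y*c≡g = m/n*n≡m (gcd[m,n]∣n d g)
    kᵇ∣ : ∀ {m} → d ^ b ∣ m → g ^ b ∣ m → k ^ b ∣ m
    kᵇ∣ {m} p q = [x*y*g]^b∣ c b (coprime-/gcd d g)
      (subst (λ t → t ^ b ∣ m) (sym x*c≡d) p) (subst (λ t → t ^ b ∣ m) (sym y*c≡g) q)
    g∣k : g ∣ k
    g∣k = divides x (trans (ℕₚ.*-assoc x y c) (cong (x *_) y*c≡g))
    kᵇ∣j : k ^ b ∣ j
    kᵇ∣j = kᵇ∣ dᵇ∣j (proj₁ (proj₂ maximum))
    1≤k : 1 ≤ k
    1≤k = ℕₚ.n≢0⇒n>0 λ k≡0 → ℕ.≢-nonZero⁻¹ j
      (0∣⇒≡0 (subst (_∣ j) (trans (cong (_^ b) k≡0) (0^b b 1≤b)) kᵇ∣j))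
      where
      0^b : ∀ b → 1 ≤ b → 0 ^ b ≡ 0
      0^b (suc b) _ = refl
    k≡g : k ≡ g
    k≡g = ℕₚ.≤-antisym
      (proj₂ (proj₂ (proj₂ maximum)) k 1≤k kᵇ∣j (kᵇ∣ dᵇ∣n (proj₁ (proj₂ (proj₂ maximum)))))
      (∣⇒≤ {{ℕ.>-nonZero 1≤k}} g∣k)

  -- The product e G is a competitor on the left-hand side. Conversely e divides the left-hand side
  -- by `∣⇒∣gcd[]`, and cancelling eᵇ turns its cofactor f into a competitor for G.
  gcd[]-* : ∀ e b j n → 1 ≤ b → 1 ≤ j → 1 ≤ e →
            gcd[ b ] (j * e ^ b) (n * e ^ b) ≡ e * gcd[ b ] j n
  gcd[]-* e b j n 1≤b 1≤j 1≤e = ℕₚ.≤-antisym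
    (subst (_≤ e * G) e*f≡G′
      (ℕₚ.*-monoʳ-≤ e (greatest f 1≤f (f∣ j (proj₁ (proj₂ scaled))) (f∣ n (proj₁ (proj₂ (proj₂ scaled)))))))
    (proj₂ (proj₂ (proj₂ scaled)) (e * G) (ℕₚ.*-mono-≤ 1≤e (proj₁ maximum))
      (G∣ j (proj₁ (proj₂ maximum))) (G∣ n (proj₁ (proj₂ (proj₂ maximum)))))
    where
    G = gcd[ b ] j n
    G′ = gcd[ b ] (j * e ^ b) (n * e ^ b)
    instance
      _ = ℕ.>-nonZero 1≤e
      _ = ℕₚ.m^n≢0 e b
    1≤jeᵇ = ℕₚ.*-mono-≤ 1≤j (ℕₚ.m^n>0 e b)
    maximum = gcd[]-isMaximum b j n 1≤b 1≤j
    greatest = proj₂ (proj₂ (proj₂ maximum))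
    scaled = gcd[]-isMaximum b (j * e ^ b) (n * e ^ b) 1≤b 1≤jeᵇ
    e∣G′ : e ∣ G′
    e∣G′ = ∣⇒∣gcd[] e b (j * e ^ b) (n * e ^ b) 1≤b 1≤jeᵇ 1≤e (n∣m*n j) (n∣m*n n)
    f = quotient e∣G′
    e*f≡G′ : e * f ≡ G′
    e*f≡G′ = sym (trans (_∣_.equality e∣G′) (ℕₚ.*-comm f e))
    1≤f : 1 ≤ f
    1≤f = ℕₚ.n≢0⇒n>0 λ f≡0 →
      ℕₚ.m<n⇒n≢0 (proj₁ scaled) (trans (sym e*f≡G′) (trans (cong (e *_) f≡0) (ℕₚ.*-zeroʳ e)))
    f∣ : ∀ m → G′ ^ b ∣ m * e ^ b → f ^ b ∣ m
    f∣ m p = *-cancelˡ-∣ (e ^ b) (subst₂ _∣_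
      (trans (cong (_^ b) (sym e*f≡G′)) (^-distribʳ-* e f b)) (ℕₚ.*-comm m (e ^ b)) p)
    G∣ : ∀ m → G ^ b ∣ m → (e * G) ^ b ∣ m * e ^ b
    G∣ m p = subst (_∣ m * e ^ b)
      (sym (trans (^-distribʳ-* e G b) (ℕₚ.*-comm (e ^ b) (G ^ b)))) (*-monoˡ-∣ (e ^ b) p)

  gcd[]≤ : ∀ b j n → 1 ≤ b → 1 ≤ j → gcd[ b ] j n ≤ j
  gcd[]≤ b@(suc b-1) j n 1≤b 1≤j with gcd[]-isMaximum b j n 1≤b 1≤j
  ... | 1≤g , gᵇ∣j , _ = ∣⇒≤ {{ℕ.>-nonZero 1≤j}} (∣-trans (m∣m*n (gcd[ b ] j n ^ b-1)) gᵇ∣j)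

-- Finite sums, and sums supported on multiples

module Sums where

  open ℚ using (_+_; _-_; _*_; -_; _≤_)
  open +-*-Solver using (solve; _:+_; _:*_; :-_; _:-_; _:=_; con)
  open CauchyFacts using (fromNat)

  𝟙 : ∀ {P : Set} → Dec P → ℚ
  𝟙 (yes _) = 1ℚ
  𝟙 (no  _) = 0ℚ

  ∑<-cong : ∀ {a b} n → (∀ k → k ℕ.< n → a k ≡ b k) → ∑< n a ≡ ∑< n b
  ∑<-cong zero    a≡b = refl
  ∑<-cong (suc n) a≡b = cong₂ _+_ (∑<-cong n (λ k k<n → a≡b k (ℕₚ.m<n⇒m<1+n k<n))) (a≡b n ℕₚ.≤-refl)

  ∑<-0 : ∀ {a} n → (∀ k → k ℕ.< n → a k ≡ 0ℚ) → ∑< n a ≡ 0ℚ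
  ∑<-0 zero    a≡0 = refl
  ∑<-0 (suc n) a≡0 = trans
    (cong₂ _+_ (∑<-0 n (λ k k<n → a≡0 k (ℕₚ.m<n⇒m<1+n k<n))) (a≡0 n ℕₚ.≤-refl)) (ℚₚ.+-identityʳ 0ℚ)

  ∑<-+ : ∀ a b n → ∑< n (λ k → a k + b k) ≡ ∑< n a + ∑< n b
  ∑<-+ a b zero    = refl
  ∑<-+ a b (suc n) = trans (cong (_+ (a n + b n)) (∑<-+ a b n))
    (solve 4 (λ x y z w → (x :+ y) :+ (z :+ w) := (x :+ z) :+ (y :+ w)) refl
      (∑< n a) (∑< n b) (a n) (b n))

  ∑<-- : ∀ a b n → ∑< n (λ k → a k - b k) ≡ ∑< n a - ∑< n b
  ∑<-- a b zero    = refl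
  ∑<-- a b (suc n) = trans (cong (_+ (a n - b n)) (∑<-- a b n))
    (solve 4 (λ x y z w → (x :- y) :+ (z :- w) := (x :+ z) :- (y :+ w)) refl
      (∑< n a) (∑< n b) (a n) (b n))

  ∑<-*ˡ : ∀ c a n → ∑< n (λ k → c * a k) ≡ c * ∑< n a
  ∑<-*ˡ c a zero    = sym (ℚₚ.*-zeroʳ c)
  ∑<-*ˡ c a (suc n) = trans (cong (_+ c * a n) (∑<-*ˡ c a n))
                            (sym (ℚₚ.*-distribˡ-+ c (∑< n a) (a n)))

  ∑<-const : ∀ c n → ∑< n (λ _ → c) ≡ c * fromNat n
  ∑<-const c zero    = sym (ℚₚ.*-zeroʳ c)
  ∑<-const c (suc n) = trans (cong (_+ c) (∑<-const c n))
    (solve 2 (λ c y → c :* y :+ c := c :* (con 1ℚ :+ y)) refl c (fromNat n))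

  ∑<-swap : ∀ (a : ℕ → ℕ → ℚ) m n →
            ∑< m (λ i → ∑< n (λ j → a i j)) ≡ ∑< n (λ j → ∑< m (λ i → a i j))
  ∑<-swap a zero    n = sym (∑<-0 n (λ _ _ → refl))
  ∑<-swap a (suc m) n = trans (cong (_+ ∑< n (a m)) (∑<-swap a m n))
                              (sym (∑<-+ (λ j → ∑< m (λ i → a i j)) (a m) n))

  ∑<-head : ∀ a n → ∑< (suc n) a ≡ a 0 + ∑< n (λ k → a (suc k))
  ∑<-head a zero    = ℚₚ.+-comm 0ℚ (a 0)
  ∑<-head a (suc n) = trans (cong (_+ a (suc n)) (∑<-head a n))
                            (ℚₚ.+-assoc (a 0) (∑< n (λ k → a (suc k))) (a (suc n)))

  ∑<-mono : ∀ {a b} n → (∀ k → k ℕ.< n → a k ≤ b k) → ∑< n a ≤ ∑< n b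
  ∑<-mono zero    a≤b = ℚₚ.≤-refl
  ∑<-mono (suc n) a≤b = ℚₚ.+-mono-≤ (∑<-mono n (λ k k<n → a≤b k (ℕₚ.m<n⇒m<1+n k<n))) (a≤b n ℕₚ.≤-refl)

  ∑<-∣∣ : ∀ a n → ℚ.∣ ∑< n a ∣ ≤ ∑< n (λ k → ℚ.∣ a k ∣)
  ∑<-∣∣ a zero    = ℚₚ.≤-refl
  ∑<-∣∣ a (suc n) = ℚₚ.≤-trans (ℚₚ.∣p+q∣≤∣p∣+∣q∣ (∑< n a) (a n)) (ℚₚ.+-monoˡ-≤ ℚ.∣ a n ∣ (∑<-∣∣ a n))

  ∑<-𝟙 : ∀ {P : ℕ → Set} (P? : ∀ k → Dec (P k)) (a : ℕ → ℚ) {n i} → i ℕ.< n → P i → (∀ k → P k → k ≡ i) →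
         ∑< n (λ k → 𝟙 (P? k) * a k) ≡ a i
  ∑<-𝟙 {P} P? a {suc n} {i} i<1+n Pi unique with ℕₚ.m<1+n⇒m<n∨m≡n i<1+n
  ... | inj₁ i<n = trans (cong₂ _+_ (∑<-𝟙 P? a i<n Pi unique) (vanish (λ Pn → ℕₚ.<⇒≢ i<n (sym (unique n Pn)))))
                         (ℚₚ.+-identityʳ (a i))
    where
    vanish : ¬ P n → 𝟙 (P? n) * a n ≡ 0ℚ
    vanish ¬Pn with P? n
    ... | yes Pn = contradiction Pn ¬Pn
    ... | no _   = ℚₚ.*-zeroˡ (a n)
  ... | inj₂ refl = trans (cong₂ _+_ (∑<-0 n below) at) (ℚₚ.+-identityˡ (a n))
    where
    below : ∀ k → k ℕ.< n → 𝟙 (P? k) * a k ≡ 0ℚ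
    below k k<n with P? k
    ... | yes Pk = contradiction (unique k Pk) (ℕₚ.<⇒≢ k<n)
    ... | no _   = ℚₚ.*-zeroˡ (a k)
    at : 𝟙 (P? n) * a n ≡ a n
    at with P? n
    ... | yes _  = ℚₚ.*-identityˡ (a n)
    ... | no ¬Pn = contradiction Pi ¬Pn

  -- The last term is peeled off, lexicographically in M and r. For r > 0 it sits at a non-multiple
  -- of q and vanishes; for r = 0 it is the multiple itself, and the induction resumes with M - 1
  -- and r = q - 1.
  ∑<-multiples : ∀ q (F : ℕ → ℚ) → (∀ m → ¬ q ∣ suc m → F (suc m) ≡ 0ℚ) → ∀ M r → r ℕ.< q →
                 ∑< (M ℕ.* q ℕ.+ r) (λ k → F (suc k)) ≡ ∑< M (λ k → F (suc k ℕ.* q))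
  ∑<-multiples q F F≡0 zero    zero    _   = refl
  ∑<-multiples (suc q) F F≡0 (suc M) zero _
    rewrite ℕₚ.+-identityʳ (q ℕ.+ M ℕ.* suc q) | ℕₚ.+-comm q (M ℕ.* suc q) =
      cong (_+ F (suc (M ℕ.* suc q ℕ.+ q))) (∑<-multiples (suc q) F F≡0 M q ℕₚ.≤-refl)
  ∑<-multiples q F F≡0 M (suc r) 1+r<q rewrite ℕₚ.+-suc (M ℕ.* q) r =
    trans (cong₂ _+_ (∑<-multiples q F F≡0 M r (ℕₚ.<-trans (ℕₚ.n<1+n r) 1+r<q)) (F≡0 _ q∤))
          (ℚₚ.+-identityʳ _)
    where
    q∤ : ¬ q ∣ suc (M ℕ.* q ℕ.+ r)
    q∤ q∣ = ℕₚ.<⇒≱ 1+r<q (∣⇒≤ (∣m+n∣m⇒∣n (subst (q ∣_) (sym (ℕₚ.+-suc (M ℕ.* q) r)) q∣) (n∣m*n M)))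

  ∑∑ : ℕ → (ℕ → ℕ → ℚ) → ℚ
  ∑∑ N F = ∑< N (λ n → ∑< (suc n) (λ j → F (suc j) (suc n)))

  -- A change of variables on the triangle 1 ≤ j ≤ n ≤ N. The outer range leaves the remainder
  -- `N ℕ.% q`; the inner ranges leave none, because n is by then a multiple of q.
  ∑∑-multiples : ∀ q .{{_ : ℕ.NonZero q}} N (F : ℕ → ℕ → ℚ) →
                 (∀ j n → ¬ q ∣ suc j → F (suc j) n ≡ 0ℚ) →
                 (∀ j n → ¬ q ∣ n → F (suc j) n ≡ 0ℚ) →
                 ∑∑ (N ℕ./ q) (λ j n → F (j ℕ.* q) (n ℕ.* q)) ≡ ∑∑ N F
  ∑∑-multiples q N F Fj≡0 Fn≡0 = begin
    ∑∑ (N ℕ./ q) (λ j n → F (j ℕ.* q) (n ℕ.* q))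
      ≡⟨ ∑<-cong (N ℕ./ q) (λ n _ → inner (suc n)) ⟨
    ∑< (N ℕ./ q) (λ n → H (suc n ℕ.* q))
      ≡⟨ ∑<-multiples q H (λ m q∤m → ∑<-0 (suc m) (λ j _ → Fn≡0 j (suc m) q∤m)) (N ℕ./ q) (N ℕ.% q) (m%n<n N q) ⟨
    ∑< (N ℕ./ q ℕ.* q ℕ.+ N ℕ.% q) (λ n → H (suc n))
      ≡⟨ cong (λ t → ∑< t (λ n → H (suc n))) (trans (m≡m%n+[m/n]*n N q) (ℕₚ.+-comm (N ℕ.% q) (N ℕ./ q ℕ.* q))) ⟨
    ∑∑ N F ∎
    where
    open ≡-Reasoning
    H : ℕ → ℚ
    H m = ∑< m (λ j → F (suc j) m)
    inner : ∀ n → H (n ℕ.* q) ≡ ∑< n (λ j → F (suc j ℕ.* q) (n ℕ.* q))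
    inner n = trans (cong (λ t → ∑< t (λ j → F (suc j) (n ℕ.* q))) (sym (ℕₚ.+-identityʳ (n ℕ.* q))))
      (∑<-multiples q (λ j → F j (n ℕ.* q)) (λ j → Fj≡0 j (n ℕ.* q)) n 0 (ℕ.>-nonZero⁻¹ q))

  ∑∑-swap : ∀ (F : ℕ → ℕ → ℕ → ℚ) m N →
            ∑< m (λ k → ∑∑ N (F k)) ≡ ∑∑ N (λ j n → ∑< m (λ k → F k j n))
  ∑∑-swap F m N = trans (∑<-swap (λ k n → ∑< (suc n) (λ j → F k (suc j) (suc n))) m N)
    (∑<-cong N (λ n _ → ∑<-swap (λ k j → F k (suc j) (suc n)) m (suc n)))

  ∑∑-cong : ∀ {F G : ℕ → ℕ → ℚ} N → (∀ j n → 1 ℕ.≤ j → j ℕ.≤ n → n ℕ.≤ N → F j n ≡ G j n) →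
            ∑∑ N F ≡ ∑∑ N G
  ∑∑-cong N F≡G = ∑<-cong N (λ n n<N → ∑<-cong (suc n) (λ j j<1+n → F≡G (suc j) (suc n) (s≤s z≤n) j<1+n n<N))

-- The identity obtained by sorting factorizations of the generalized gcd

module Convolution where

  open ℚ using (_+_; _*_)
  open +-*-Solver using (solve; _:+_; _:*_; _:=_; con)
  open CauchyFacts using (fromNat)
  open GeneralizedGcd
  open Sums

  -- Throughout, k encodes e = k + 1: the divisor is never zero, and `∑< N` runs over 1 ≤ e ≤ N.
  ⌊_/1+_^_⌋ : ℕ → ℕ → ℕ → ℕ
  ⌊ N /1+ k ^ b ⌋ = (N ℕ./ suc k ℕ.^ b) {{ℕₚ.m^n≢0 (suc k) b}}

  gcdSum : ℕ → ℕ → ℚ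
  gcdSum b N = ∑∑ N (λ j n → fromNat (gcd[ b ] j n))

  -- The triangle has N (N + 1) / 2 points. Doubling avoids the division, and is the source of the
  -- factor `fromNat 2` in `remainder`.
  2*∑∑-const : ∀ c N → fromNat 2 * ∑∑ N (λ _ _ → c) ≡ c * (fromNat N * fromNat N + fromNat N)
  2*∑∑-const c zero    = sym (ℚₚ.*-zeroʳ c)
  2*∑∑-const c (suc N) = begin
    two * (∑∑ N (λ _ _ → c) + ∑< (suc N) (λ _ → c))
      ≡⟨ ℚₚ.*-distribˡ-+ two (∑∑ N (λ _ _ → c)) (∑< (suc N) (λ _ → c)) ⟩
    two * ∑∑ N (λ _ _ → c) + two * ∑< (suc N) (λ _ → c)
      ≡⟨ cong₂ (λ s t → s + two * t) (2*∑∑-const c N) (∑<-const c (suc N)) ⟩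
    c * (x * x + x) + two * (c * (1ℚ + x))
      ≡⟨ solve 2 (λ c x → c :* (x :* x :+ x) :+ con two :* (c :* (con 1ℚ :+ x)) :=
           c :* ((con 1ℚ :+ x) :* (con 1ℚ :+ x) :+ (con 1ℚ :+ x))) refl c x ⟩
    c * ((1ℚ + x) * (1ℚ + x) + (1ℚ + x)) ∎
    where
    open ≡-Reasoning
    two = fromNat 2
    x = fromNat N

  -- Both sides sum over the factorizations e f = (j , n)_b, weighted by f and
  -- by e respectively, because dividing j and n by e ^ b turns (j , n)_b into f.
  ∑-gcdSum : ∀ b N → 1 ℕ.≤ b →
             ∑< N (λ k → gcdSum b ⌊ N /1+ k ^ b ⌋) ≡
             ∑< N (λ k → ∑∑ ⌊ N /1+ k ^ b ⌋ (λ _ _ → fromNat (suc k)))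
  ∑-gcdSum b N 1≤b = begin
    ∑< N (λ k → gcdSum b ⌊ N /1+ k ^ b ⌋)
      ≡⟨ ∑<-cong N (λ k _ → trans
           (∑∑-cong ⌊ N /1+ k ^ b ⌋ (λ j n 1≤j j≤n n≤M → sym (at-multiples (λ _ f → fromNat f) k j n 1≤j j≤n n≤M)))
           (unscale (λ _ f → fromNat f) k)) ⟩
    ∑< N (λ k → ∑∑ N (factorSum (λ _ f → fromNat f) k))
      ≡⟨ ∑∑-swap (factorSum (λ _ f → fromNat f)) N N ⟩
    ∑∑ N (λ j n → ∑< N (λ k → factorSum (λ _ f → fromNat f) k j n))
      ≡⟨ ∑∑-cong N (λ j n _ _ _ → symmetric j n) ⟩
    ∑∑ N (λ j n → ∑< N (λ k → factorSum (λ e _ → fromNat e) k j n))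
      ≡⟨ ∑∑-swap (factorSum (λ e _ → fromNat e)) N N ⟨
    ∑< N (λ k → ∑∑ N (factorSum (λ e _ → fromNat e) k))
      ≡⟨ ∑<-cong N (λ k _ → trans
           (∑∑-cong ⌊ N /1+ k ^ b ⌋ (λ j n 1≤j j≤n n≤M → sym (at-multiples (λ e _ → fromNat e) k j n 1≤j j≤n n≤M)))
           (unscale (λ e _ → fromNat e) k)) ⟨
    ∑< N (λ k → ∑∑ ⌊ N /1+ k ^ b ⌋ (λ _ _ → fromNat (suc k))) ∎
    where
    open ≡-Reasoning

    -- For fixed e = k + 1 this has at most one nonzero term, the cofactor f = l + 1 with e f = (j ,
    -- n)_b. Keeping f as a summation index with the same range as e makes the exchange of e and f a
    -- plain swap of sums.
    factorSum : (ℕ → ℕ → ℚ) → ℕ → ℕ → ℕ → ℚ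
    factorSum w k j n = ∑< N (λ l → 𝟙 (suc k ℕ.* suc l ℕₚ.≟ gcd[ b ] j n) * w (suc k) (suc l))

    symmetric : ∀ j n → ∑< N (λ k → factorSum (λ _ f → fromNat f) k j n) ≡
                        ∑< N (λ k → factorSum (λ e _ → fromNat e) k j n)
    symmetric j n = trans
      (∑<-swap (λ k l → 𝟙 (suc k ℕ.* suc l ℕₚ.≟ gcd[ b ] j n) * fromNat (suc l)) N N)
      (∑<-cong N (λ l _ → ∑<-cong N (λ k _ →
        cong (λ t → 𝟙 (t ℕₚ.≟ gcd[ b ] j n) * fromNat (suc l)) (ℕₚ.*-comm (suc k) (suc l)))))

    -- By `gcd[]-*` the only cofactor is (j , n)_b, and it lies in the range of l because (j , n)_b
    -- ≤ j ≤ n ≤ ⌊N/eᵇ⌋ ≤ N.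
    at-multiples : ∀ w k j n → 1 ℕ.≤ j → j ℕ.≤ n → n ℕ.≤ ⌊ N /1+ k ^ b ⌋ →
      factorSum w k (j ℕ.* suc k ℕ.^ b) (n ℕ.* suc k ℕ.^ b) ≡ w (suc k) (gcd[ b ] j n)
    at-multiples w k j n 1≤j j≤n n≤M = trans
      (cong (λ t → ∑< N (λ l → 𝟙 (suc k ℕ.* suc l ℕₚ.≟ t) * w (suc k) (suc l)))
        (gcd[]-* (suc k) b j n 1≤b 1≤j (s≤s z≤n)))
      (select (gcd[ b ] j n) (proj₁ (gcd[]-isMaximum b j n 1≤b 1≤j))
        (ℕₚ.≤-trans (gcd[]≤ b j n 1≤b 1≤j)
          (ℕₚ.≤-trans j≤n (ℕₚ.≤-trans n≤M (m/n≤m N (suc k ℕ.^ b) {{ℕₚ.m^n≢0 (suc k) b}})))))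
      where
      select : ∀ g → 1 ℕ.≤ g → g ℕ.≤ N →
        ∑< N (λ l → 𝟙 (suc k ℕ.* suc l ℕₚ.≟ suc k ℕ.* g) * w (suc k) (suc l)) ≡ w (suc k) g
      select (suc g) _ g<N = ∑<-𝟙 (λ l → suc k ℕ.* suc l ℕₚ.≟ suc k ℕ.* suc g) (λ l → w (suc k) (suc l)) g<N refl
        (λ l eq → ℕₚ.suc-injective (ℕₚ.*-cancelˡ-≡ (suc l) (suc g) (suc k) eq))

    -- The b-th power of (j , n)_b divides j and n. So if eᵇ fails to divide one of them, e does not
    -- divide (j , n)_b, and no cofactor exists.
    unscale : ∀ w k →
      ∑∑ ⌊ N /1+ k ^ b ⌋ (λ j n → factorSum w k (j ℕ.* suc k ℕ.^ b) (n ℕ.* suc k ℕ.^ b)) ≡ ∑∑ N (factorSum w k)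
    unscale w k = ∑∑-multiples (suc k ℕ.^ b) {{ℕₚ.m^n≢0 (suc k) b}} N (factorSum w k)
      (λ j n eᵇ∤j → vanish j n (λ e∣g → eᵇ∤j (∣-trans (^-monoˡ-∣ b e∣g) (proj₁ (proj₂ (maximum j n))))))
      (λ j n eᵇ∤n → vanish j n (λ e∣g → eᵇ∤n (∣-trans (^-monoˡ-∣ b e∣g) (proj₁ (proj₂ (proj₂ (maximum j n)))))))
      where
      maximum : ∀ j n → _
      maximum j n = gcd[]-isMaximum b (suc j) n 1≤b (s≤s z≤n)
      vanish : ∀ j n → ¬ suc k ∣ gcd[ b ] (suc j) n → factorSum w k (suc j) n ≡ 0ℚ
      vanish j n e∤g = ∑<-0 N term≡0
        where
        term≡0 : ∀ l → l ℕ.< N → 𝟙 (suc k ℕ.* suc l ℕₚ.≟ gcd[ b ] (suc j) n) * w (suc k) (suc l) ≡ 0ℚ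
        term≡0 l _ with suc k ℕ.* suc l ℕₚ.≟ gcd[ b ] (suc j) n
        ... | yes eq = contradiction (subst (suc k ∣_) eq (m∣m*n (suc l))) e∤g
        ... | no _   = ℚₚ.*-zeroˡ (w (suc k) (suc l))

-- Absolute values, floors and embedded naturals

module Inequalities where

  open ℚ using (_+_; _-_; _*_; -_; _≤_; ∣_∣)
  open +-*-Solver using (solve; _:+_; _:*_; :-_; _:-_; _:=_; con)
  open CauchyFacts

  ∣+∣≤ : ∀ {p q P Q} → ∣ p ∣ ≤ P → ∣ q ∣ ≤ Q → ∣ p + q ∣ ≤ P + Q
  ∣+∣≤ {p} {q} p≤P q≤Q = ℚₚ.≤-trans (ℚₚ.∣p+q∣≤∣p∣+∣q∣ p q) (ℚₚ.+-mono-≤ p≤P q≤Q)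

  ∣-∣≤ : ∀ {p q P Q} → ∣ p ∣ ≤ P → ∣ q ∣ ≤ Q → ∣ p - q ∣ ≤ P + Q
  ∣-∣≤ {p} {q} p≤P q≤Q = ℚₚ.≤-trans (ℚₚ.∣p-q∣≤∣p∣+∣q∣ p q) (ℚₚ.+-mono-≤ p≤P q≤Q)

  ∣*∣≤ : ∀ {p q P Q} → ∣ p ∣ ≤ P → ∣ q ∣ ≤ Q → ∣ p * q ∣ ≤ P * Q
  ∣*∣≤ {p} {q} p≤P q≤Q = subst (_≤ _) (sym (ℚₚ.∣p*q∣≡∣p∣*∣q∣ p q))
    (*-mono (ℚₚ.0≤∣p∣ p) (ℚₚ.≤-trans (ℚₚ.0≤∣p∣ q) q≤Q) p≤P q≤Q)

  0≤p≤q⇒∣p∣≤q : ∀ {p q} → 0ℚ ≤ p → p ≤ q → ∣ p ∣ ≤ q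
  0≤p≤q⇒∣p∣≤q 0≤p p≤q = subst (_≤ _) (sym (ℚₚ.0≤p⇒∣p∣≡p 0≤p)) p≤q

  p≤q+r⇒p-q≤r : ∀ {p} q {r} → p ≤ q + r → p - q ≤ r
  p≤q+r⇒p-q≤r {p} q {r} p≤q+r = subst (p - q ≤_)
    (solve 2 (λ q r → (q :+ r) :- q := r) refl q r) (ℚₚ.+-monoˡ-≤ (- q) p≤q+r)

  -- Both one-sided bounds factor into nonnegative factors: x - (m² + m - x²) = (x - m)(1 + x + m)
  -- and x + (m² + m - x²) = (1 + m - x)(x + m).
  floor-∣m²+m-x²∣≤x : ∀ {m x} → 0ℚ ≤ m → m ≤ x → x ≤ 1ℚ + m → ∣ (m * m + m) - x * x ∣ ≤ x
  floor-∣m²+m-x²∣≤x {m} {x} 0≤m m≤x x≤1+m = ∣p∣≤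
    (0≤-⇒≤ (subst (0ℚ ≤_)
      (solve 2 (λ m x → (x :- m) :* (con 1ℚ :+ (x :+ m)) := x :- ((m :* m :+ m) :- x :* x)) refl m x)
      (nonNeg-* (≤⇒0≤- m≤x) (ℚₚ.≤-trans 0≤x+m (q≤p+q 0≤1)))))
    (0≤-⇒≤ (subst (0ℚ ≤_)
      (solve 2 (λ m x → ((con 1ℚ :+ m) :- x) :* (x :+ m) := x :- (:- ((m :* m :+ m) :- x :* x))) refl m x)
      (nonNeg-* (≤⇒0≤- x≤1+m) 0≤x+m)))
    where
    0≤x+m : 0ℚ ≤ x + m
    0≤x+m = ℚₚ.≤-trans (ℚₚ.≤-trans 0≤m m≤x) (p≤p+q 0≤m)

  floor-∣m²-x²∣≤2x : ∀ {m x} → 0ℚ ≤ m → m ≤ x → x ≤ 1ℚ + m → ∣ m * m - x * x ∣ ≤ x + x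
  floor-∣m²-x²∣≤2x {m} {x} 0≤m m≤x x≤1+m =
    subst (λ t → ∣ t ∣ ≤ x + x) (solve 2 (λ m x → ((m :* m :+ m) :- x :* x) :- m := m :* m :- x :* x) refl m x)
      (∣-∣≤ (floor-∣m²+m-x²∣≤x 0≤m m≤x x≤1+m) (0≤p≤q⇒∣p∣≤q 0≤m m≤x))

  fromNat-+ : ∀ m n → fromNat (m ℕ.+ n) ≡ fromNat m + fromNat n
  fromNat-+ zero    n = sym (ℚₚ.+-identityˡ (fromNat n))
  fromNat-+ (suc m) n = trans (cong (1ℚ +_) (fromNat-+ m n)) (sym (ℚₚ.+-assoc 1ℚ (fromNat m) (fromNat n)))

  fromNat-* : ∀ m n → fromNat (m ℕ.* n) ≡ fromNat m * fromNat n
  fromNat-* zero    n = sym (ℚₚ.*-zeroˡ (fromNat n))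
  fromNat-* (suc m) n = trans (fromNat-+ n (m ℕ.* n)) (trans (cong (fromNat n +_) (fromNat-* m n))
    (solve 2 (λ m n → n :+ m :* n := (con 1ℚ :+ m) :* n) refl (fromNat m) (fromNat n)))

  0≤fromNat : ∀ n → 0ℚ ≤ fromNat n
  0≤fromNat zero    = ℚₚ.≤-refl
  0≤fromNat (suc n) = ℚₚ.≤-trans (0≤fromNat n) (q≤p+q 0≤1)

  fromNat-mono : ∀ {m n} → m ℕ.≤ n → fromNat m ≤ fromNat n
  fromNat-mono {n = n} z≤n = 0≤fromNat n
  fromNat-mono (s≤s m≤n) = ℚₚ.+-monoʳ-≤ 1ℚ (fromNat-mono m≤n)

  /1≡fromNat : ∀ n → ℤ.+ n ℚ./ 1 ≡ fromNat n
  /1≡fromNat n = ℚₚ.toℚᵘ-injective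
    (ℚᵘₚ.≃-trans (ℚₚ.toℚᵘ-fromℚᵘ (mkℚᵘ (ℤ.+ n) 0)) (ℚᵘₚ.≃-sym (fromNat-/1 n)))

  recip-*′ : ∀ m n .{{_ : ℕ.NonZero m}} .{{_ : ℕ.NonZero n}} .{{_ : ℕ.NonZero (m ℕ.* n)}} →
             recip (m ℕ.* n) ≡ recip m * recip n
  recip-*′ (suc m) (suc n) = recip-* m n

  recip-inverse′ : ∀ n .{{_ : ℕ.NonZero n}} → recip n * fromNat n ≡ 1ℚ
  recip-inverse′ (suc n) = recip-inverse n

  module _ (N q : ℕ) .{{_ : ℕ.NonZero q}} where

    /≤*recip : fromNat (N ℕ./ q) ≤ fromNat N * recip q
    /≤*recip = begin
      M                              ≡⟨ ℚₚ.*-identityʳ M ⟨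
      M * 1ℚ                         ≡⟨ cong (M *_) (trans (ℚₚ.*-comm (fromNat q) (recip q)) (recip-inverse′ q)) ⟨
      M * (fromNat q * recip q)      ≡⟨ ℚₚ.*-assoc M (fromNat q) (recip q) ⟨
      M * fromNat q * recip q        ≡⟨ cong (_* recip q) (fromNat-* (N ℕ./ q) q) ⟨
      fromNat (N ℕ./ q ℕ.* q) * recip q ≤⟨ *-monoʳ (0≤recip q) (fromNat-mono (m/n*n≤m N q)) ⟩
      fromNat N * recip q ∎
      where
      open ℚₚ.≤-Reasoning
      M = fromNat (N ℕ./ q)

    *recip≤1+/ : fromNat N * recip q ≤ 1ℚ + fromNat (N ℕ./ q)
    *recip≤1+/ = begin
      fromNat N * recip q                ≤⟨ *-monoʳ (0≤recip q) (fromNat-mono N≤) ⟩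
      fromNat (suc (N ℕ./ q) ℕ.* q) * recip q ≡⟨ cong (_* recip q) (fromNat-* (suc (N ℕ./ q)) q) ⟩
      M * fromNat q * recip q            ≡⟨ ℚₚ.*-assoc M (fromNat q) (recip q) ⟩
      M * (fromNat q * recip q)          ≡⟨ cong (M *_) (trans (ℚₚ.*-comm (fromNat q) (recip q)) (recip-inverse′ q)) ⟩
      M * 1ℚ                             ≡⟨ ℚₚ.*-identityʳ M ⟩
      M ∎
      where
      open ℚₚ.≤-Reasoning
      M = fromNat (suc (N ℕ./ q))
      N≤ : N ℕ.≤ suc (N ℕ./ q) ℕ.* q
      N≤ = subst (ℕ._≤ suc (N ℕ./ q) ℕ.* q) (sym (m≡m%n+[m/n]*n N q))
        (ℕₚ.+-monoˡ-≤ (N ℕ./ q ℕ.* q) (ℕₚ.<⇒≤ (m%n<n N q)))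

  ∑<-mono-length : ∀ {a m n} → (∀ k → 0ℚ ≤ a k) → m ℕ.≤ n → ∑< m a ≤ ∑< n a
  ∑<-mono-length {a} 0≤a m≤n = go (ℕₚ.≤⇒≤′ m≤n)
    where
    go : ∀ {m n} → m ℕ.≤′ n → ∑< m a ≤ ∑< n a
    go ℕ.≤′-refl          = ℚₚ.≤-refl
    go (ℕ.≤′-step {n} m≤n) = ℚₚ.≤-trans (go m≤n) (p≤p+q (0≤a n))

  ∑<-close : ∀ {a b c : ℕ → ℚ} n → (∀ k → k ℕ.< n → ∣ a k - b k ∣ ≤ c k) → ∣ ∑< n a - ∑< n b ∣ ≤ ∑< n c
  ∑<-close zero    a-b≤c = ℚₚ.≤-refl
  ∑<-close {a} {b} (suc n) a-b≤c = subst (λ t → ∣ t ∣ ≤ _)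
    (solve 4 (λ x y z w → (x :- y) :+ (z :- w) := (x :+ z) :- (y :+ w)) refl (∑< n a) (∑< n b) (a n) (b n))
    (∣+∣≤ (∑<-close n (λ k k<n → a-b≤c k (ℕₚ.m<n⇒m<1+n k<n))) (a-b≤c n ℕₚ.≤-refl))

-- Partial sums and tails of the zeta series

module Zeta where

  open ℚ using (_+_; _-_; _*_; _≤_)
  open +-*-Solver using (solve; _:+_; _:-_; _:=_; con)
  open CauchyFacts
  open Sums
  open Inequalities

  ζ-term-0 : ∀ s → ζ-term s 0 ≡ 1ℚ
  ζ-term-0 s = ℚₚ./-cong {ℤ.+ 1} {1 ℕ.^ s} {ℤ.+ 1} {1} {{ℕₚ.m^n≢0 1 s}} refl (ℕₚ.^-zeroˡ s)

  ζ-term-suc : ∀ s k → ζ-term (suc s) k ≡ recip (suc k) * ζ-term s k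
  ζ-term-suc s k = recip-*′ (suc k) (suc k ℕ.^ s) {{_}} {{ℕₚ.m^n≢0 (suc k) s}} {{ℕₚ.m^n≢0 (suc k) (suc s)}}

  ζ-term-+ : ∀ s t k → ζ-term (s ℕ.+ t) k ≡ ζ-term s k * ζ-term t k
  ζ-term-+ zero    t k = sym (ℚₚ.*-identityˡ (ζ-term t k))
  ζ-term-+ (suc s) t k = begin
    ζ-term (suc (s ℕ.+ t)) k                ≡⟨ ζ-term-suc (s ℕ.+ t) k ⟩
    recip (suc k) * ζ-term (s ℕ.+ t) k      ≡⟨ cong (recip (suc k) *_) (ζ-term-+ s t k) ⟩
    recip (suc k) * (ζ-term s k * ζ-term t k) ≡⟨ ℚₚ.*-assoc (recip (suc k)) (ζ-term s k) (ζ-term t k) ⟨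
    recip (suc k) * ζ-term s k * ζ-term t k ≡⟨ cong (_* ζ-term t k) (ζ-term-suc s k) ⟨
    ζ-term (suc s) k * ζ-term t k ∎
    where open ≡-Reasoning

  fromNat*ζ-term : ∀ s k → fromNat (suc k) * ζ-term (suc s) k ≡ ζ-term s k
  fromNat*ζ-term s k = begin
    e * ζ-term (suc s) k           ≡⟨ cong (e *_) (ζ-term-suc s k) ⟩
    e * (recip (suc k) * ζ-term s k) ≡⟨ ℚₚ.*-assoc e (recip (suc k)) (ζ-term s k) ⟨
    e * recip (suc k) * ζ-term s k ≡⟨ cong (_* ζ-term s k) (trans (ℚₚ.*-comm e (recip (suc k))) (recip-inverse k)) ⟩
    1ℚ * ζ-term s k                ≡⟨ ℚₚ.*-identityˡ (ζ-term s k) ⟩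
    ζ-term s k ∎
    where
    open ≡-Reasoning
    e = fromNat (suc k)

  ζ-term-antimono : ∀ s k → ζ-term (suc s) k ≤ ζ-term s k
  ζ-term-antimono s k = subst₂ _≤_ (sym (ζ-term-suc s k)) (ℚₚ.*-identityˡ (ζ-term s k))
    (*-monoʳ (0≤ζ-term s k) (recip-antimono 1 (suc k) (s≤s z≤n)))

  ζ-partialSum-mono : ∀ s {m n} → m ℕ.≤ n → ζ-partialSum s m ≤ ζ-partialSum s n
  ζ-partialSum-mono s = ∑<-mono-length (0≤ζ-term s)

  0≤ζ-partialSum : ∀ s n → 0ℚ ≤ ζ-partialSum s n
  0≤ζ-partialSum s n = ζ-partialSum-mono s {0} {n} z≤n

  module _ (s : ℕ) (2≤s : 2 ℕ.≤ s) where

    ζ-tail : ∀ m n .{{_ : ℕ.NonZero m}} → m ℕ.≤ n → ζ-partialSum s n ≤ ζ-partialSum s m + recip m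
    ζ-tail (suc m) n m≤n = go (ℕₚ.≤⇒≤′ m≤n)
      where
      open ℚₚ.≤-Reasoning
      strengthened : ∀ {n} → suc m ℕ.≤′ suc n → ζ-partialSum s (suc n) + recip (suc n) ≤ ζ-partialSum s (suc m) + recip (suc m)
      strengthened ℕ.≤′-refl = ℚₚ.≤-refl
      strengthened {suc n} (ℕ.≤′-step m≤n) = begin
        (Z + ζ-term s (suc n)) + recip (2 ℕ.+ n)
          ≤⟨ ℚₚ.+-monoˡ-≤ (recip (2 ℕ.+ n)) (ℚₚ.+-monoʳ-≤ Z (ζ-term-bound s 2≤s n)) ⟩
        (Z + (recip (suc n) - recip (2 ℕ.+ n))) + recip (2 ℕ.+ n)
          ≡⟨ solve 3 (λ z x y → (z :+ (x :- y)) :+ y := z :+ x) refl Z (recip (suc n)) (recip (2 ℕ.+ n)) ⟩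
        Z + recip (suc n)
          ≤⟨ strengthened m≤n ⟩
        ζ-partialSum s (suc m) + recip (suc m) ∎
        where Z = ζ-partialSum s (suc n)
      strengthened {zero} (ℕ.≤′-step m≤0) with ℕₚ.≤′⇒≤ m≤0
      ... | ()
      go : ∀ {n} → suc m ℕ.≤′ n → ζ-partialSum s n ≤ ζ-partialSum s (suc m) + recip (suc m)
      go {zero}  m≤0 with ℕₚ.≤′⇒≤ m≤0
      ... | ()
      go {suc n} m≤n = ℚₚ.≤-trans (p≤p+q (0≤recip (suc n))) (strengthened m≤n)

    ζ-partialSum≤2 : ∀ n → ζ-partialSum s n ≤ fromNat 2
    ζ-partialSum≤2 zero    = 0≤fromNat 2
    ζ-partialSum≤2 (suc n) = subst (λ t → ζ-partialSum s (suc n) ≤ (0ℚ + t) + recip 1) (ζ-term-0 s)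
      (ζ-tail 1 (suc n) (s≤s z≤n))

    -- The term k = 0 of ∑< is 2^{−s} ≤ 1/4, and the terms from 3^{−s} on telescope to at most 1/2.
    ∑ζ-term∘suc≤¾ : ∀ n → ∑< n (λ k → ζ-term s (suc k)) ≤ ℤ.+ 3 ℚ./ 4
    ∑ζ-term∘suc≤¾ zero    = ℚₚ.≤ᵇ⇒≤ tt
    ∑ζ-term∘suc≤¾ (suc n) = begin
      ∑< (suc n) (λ k → ζ-term s (suc k))
        ≡⟨ solve 2 (λ x y → y := (x :+ y) :- x) refl (ζ-term s 0) _ ⟩
      ζ-term s 0 + ∑< (suc n) (λ k → ζ-term s (suc k)) - ζ-term s 0
        ≡⟨ cong (_- ζ-term s 0) (∑<-head (ζ-term s) (suc n)) ⟨
      ζ-partialSum s (2 ℕ.+ n) - ζ-term s 0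
        ≤⟨ p≤q+r⇒p-q≤r (ζ-term s 0) (ℚₚ.≤-trans (ζ-tail 2 (2 ℕ.+ n) (s≤s (s≤s z≤n)))
             (ℚₚ.≤-reflexive (solve 3 (λ x y z → (con 0ℚ :+ x :+ y) :+ z := x :+ (y :+ z)) refl (ζ-term s 0) (ζ-term s 1) ½))) ⟩
      ζ-term s 1 + ½
        ≤⟨ ℚₚ.+-monoˡ-≤ ½ (recip-antimono 4 (2 ℕ.^ s) {{_}} {{ℕₚ.m^n≢0 2 s}} (ℕₚ.^-monoʳ-≤ 2 2≤s)) ⟩
      recip 4 + ½ ∎
      where open ℚₚ.≤-Reasoning

-- The bound for f(N) with truncated zeta values

-- Here s stands for b − 1.
module Estimate (s : ℕ) (1≤s : 1 ℕ.≤ s) (n : ℕ) where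

  open ℚ using (_+_; _-_; _*_; -_; _≤_; ∣_∣)
  open +-*-Solver using (solve; _:+_; _:*_; :-_; _:-_; _:=_; con)
  open CauchyFacts
  open Sums
  open Convolution
  open Inequalities
  open Zeta

  private
    b = suc s
    -- The exponents are 2b - 1 and 2b, written as sums so that `ζ-term-+` can split the terms.
    Z₁ = ζ-partialSum (s ℕ.+ b) n
    Z₂ = ζ-partialSum (b ℕ.+ b) n

    2≤s+b : 2 ℕ.≤ s ℕ.+ b
    2≤s+b = ℕₚ.+-mono-≤ 1≤s (s≤s z≤n)

    2≤b+b : 2 ℕ.≤ b ℕ.+ b
    2≤b+b = ℕₚ.m≤n⇒m≤1+n 2≤s+b

    W : ℕ → ℚ
    W = ζ-partialSum s

    ∣Z₁∣≤2 : ∣ Z₁ ∣ ≤ fromNat 2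
    ∣Z₁∣≤2 = 0≤p≤q⇒∣p∣≤q (0≤ζ-partialSum (s ℕ.+ b) n) (ζ-partialSum≤2 (s ℕ.+ b) 2≤s+b n)

    ∣Z₂∣≤2 : ∣ Z₂ ∣ ≤ fromNat 2
    ∣Z₂∣≤2 = 0≤p≤q⇒∣p∣≤q (0≤ζ-partialSum (b ℕ.+ b) n) (ζ-partialSum≤2 (b ℕ.+ b) 2≤b+b n)

  remainder : ℕ → ℚ
  remainder N = Z₂ * (fromNat 2 * gcdSum b N) - Z₁ * (fromNat N * fromNat N)

  module _ (N : ℕ) where

    private
      M : ℕ → ℕ
      M k = ⌊ N /1+ k ^ b ⌋

      m x w e : ℕ → ℚ
      m k = fromNat (M k)
      x k = fromNat N * ζ-term b k
      w k = ζ-term s k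
      e k = fromNat (suc k)

      m≤x : ∀ k → m k ≤ x k
      m≤x k = /≤*recip N (suc k ℕ.^ b) {{ℕₚ.m^n≢0 (suc k) b}}

      x≤1+m : ∀ k → x k ≤ 1ℚ + m k
      x≤1+m k = *recip≤1+/ N (suc k ℕ.^ b) {{ℕₚ.m^n≢0 (suc k) b}}

      N² = fromNat N * fromNat N
      -- Replacing each floor `m k` by the exact quotient `x k` = N/eᵇ, and dropping the linear term
      -- in `A`, turns `A` into `Y₁` and `B` into `Y₂`.
      A = ∑< N (λ k → e k * (m k * m k + m k))
      B = ∑< N (λ k → m k * m k)
      Y₁ = N² * ζ-partialSum (s ℕ.+ b) N
      Y₂ = N² * ζ-partialSum (b ℕ.+ b) N

      ∑-remainder : ∑< N (λ k → remainder (M k)) ≡ Z₂ * A - Z₁ * B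
      ∑-remainder = begin
        ∑< N (λ k → remainder (M k))
          ≡⟨ ∑<-- (λ k → Z₂ * (fromNat 2 * gcdSum b (M k))) (λ k → Z₁ * (m k * m k)) N ⟩
        ∑< N (λ k → Z₂ * (fromNat 2 * gcdSum b (M k))) - ∑< N (λ k → Z₁ * (m k * m k))
          ≡⟨ cong₂ _-_ (∑<-*ˡ Z₂ (λ k → fromNat 2 * gcdSum b (M k)) N) (∑<-*ˡ Z₁ (λ k → m k * m k) N) ⟩
        Z₂ * ∑< N (λ k → fromNat 2 * gcdSum b (M k)) - Z₁ * B
          ≡⟨ cong (λ t → Z₂ * t - Z₁ * B) ∑-2gcdSum ⟩
        Z₂ * A - Z₁ * B ∎
        where
        open ≡-Reasoning
        ∑-2gcdSum : ∑< N (λ k → fromNat 2 * gcdSum b (M k)) ≡ A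
        ∑-2gcdSum = begin
          ∑< N (λ k → fromNat 2 * gcdSum b (M k))
            ≡⟨ ∑<-*ˡ (fromNat 2) (λ k → gcdSum b (M k)) N ⟩
          fromNat 2 * ∑< N (λ k → gcdSum b (M k))
            ≡⟨ cong (fromNat 2 *_) (∑-gcdSum b N (s≤s z≤n)) ⟩
          fromNat 2 * ∑< N (λ k → ∑∑ (M k) (λ _ _ → e k))
            ≡⟨ ∑<-*ˡ (fromNat 2) (λ k → ∑∑ (M k) (λ _ _ → e k)) N ⟨
          ∑< N (λ k → fromNat 2 * ∑∑ (M k) (λ _ _ → e k))
            ≡⟨ ∑<-cong N (λ k _ → 2*∑∑-const (e k) (M k)) ⟩
          A ∎

      e*x≡ : ∀ k → e k * x k ≡ fromNat N * w k
      e*x≡ k = trans (solve 3 (λ e n r → e :* (n :* r) := n :* (e :* r)) refl (e k) (fromNat N) (ζ-term b k))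
                     (cong (fromNat N *_) (fromNat*ζ-term s k))

      x*x≡ : ∀ k → x k * x k ≡ N² * ζ-term (b ℕ.+ b) k
      x*x≡ k = trans (solve 2 (λ n r → (n :* r) :* (n :* r) := (n :* n) :* (r :* r)) refl (fromNat N) (ζ-term b k))
                     (cong (N² *_) (sym (ζ-term-+ b b k)))

      e*x*x≡ : ∀ k → e k * (x k * x k) ≡ N² * ζ-term (s ℕ.+ b) k
      e*x*x≡ k = begin
        e k * (x k * x k)             ≡⟨ ℚₚ.*-assoc (e k) (x k) (x k) ⟨
        e k * x k * x k               ≡⟨ cong (_* x k) (e*x≡ k) ⟩
        fromNat N * w k * x k         ≡⟨ solve 3 (λ n w r → (n :* w) :* (n :* r) := (n :* n) :* (w :* r)) refl (fromNat N) (w k) (ζ-term b k) ⟩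
        N² * (w k * ζ-term b k)       ≡⟨ cong (N² *_) (ζ-term-+ s b k) ⟨
        N² * ζ-term (s ℕ.+ b) k ∎
        where open ≡-Reasoning

      -- The floor error for one e is at most e · N/eᵇ = N e^{1-b}; summing over e produces W.
      ∣A-Y₁∣≤ : ∣ A - Y₁ ∣ ≤ fromNat N * W N
      ∣A-Y₁∣≤ = subst₂ (λ y t → ∣ A - y ∣ ≤ t)
        (∑<-*ˡ N² (ζ-term (s ℕ.+ b)) N) (∑<-*ˡ (fromNat N) w N)
        (∑<-close N (λ k _ → termwise k))
        where
        open ℚₚ.≤-Reasoning
        termwise : ∀ k → ∣ e k * (m k * m k + m k) - N² * ζ-term (s ℕ.+ b) k ∣ ≤ fromNat N * w k
        termwise k = begin
          ∣ e k * (m k * m k + m k) - N² * ζ-term (s ℕ.+ b) k ∣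
            ≡⟨ cong (λ t → ∣ e k * (m k * m k + m k) - t ∣) (e*x*x≡ k) ⟨
          ∣ e k * (m k * m k + m k) - e k * (x k * x k) ∣
            ≡⟨ cong ∣_∣ (solve 3 (λ e y z → e :* y :- e :* z := e :* (y :- z)) refl (e k) (m k * m k + m k) (x k * x k)) ⟩
          ∣ e k * (m k * m k + m k - x k * x k) ∣
            ≤⟨ ∣*∣≤ (0≤p≤q⇒∣p∣≤q (0≤fromNat (suc k)) ℚₚ.≤-refl)
                    (floor-∣m²+m-x²∣≤x (0≤fromNat (M k)) (m≤x k) (x≤1+m k)) ⟩
          e k * x k
            ≡⟨ e*x≡ k ⟩
          fromNat N * w k ∎

      ∣B-Y₂∣≤ : ∣ B - Y₂ ∣ ≤ fromNat 2 * (fromNat N * W N)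
      ∣B-Y₂∣≤ = subst₂ (λ y t → ∣ B - y ∣ ≤ t)
        (∑<-*ˡ N² (ζ-term (b ℕ.+ b)) N)
        (trans (∑<-*ˡ (fromNat 2) (λ k → fromNat N * w k) N) (cong (fromNat 2 *_) (∑<-*ˡ (fromNat N) w N)))
        (∑<-close N (λ k _ → termwise k))
        where
        open ℚₚ.≤-Reasoning
        termwise : ∀ k → ∣ m k * m k - N² * ζ-term (b ℕ.+ b) k ∣ ≤ fromNat 2 * (fromNat N * w k)
        termwise k = begin
          ∣ m k * m k - N² * ζ-term (b ℕ.+ b) k ∣ ≡⟨ cong (λ t → ∣ m k * m k - t ∣) (x*x≡ k) ⟨
          ∣ m k * m k - x k * x k ∣   ≤⟨ floor-∣m²-x²∣≤2x (0≤fromNat (M k)) (m≤x k) (x≤1+m k) ⟩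
          x k + x k                   ≡⟨ solve 1 (λ x → x :+ x := con (fromNat 2) :* x) refl (x k) ⟩
          fromNat 2 * x k             ≤⟨ *-monoˡ (0≤fromNat 2) (*-monoˡ (0≤fromNat N) (ζ-term-antimono s k)) ⟩
          fromNat 2 * (fromNat N * w k) ∎

    -- The product N² Z₁ Z₂ occurs with both signs and cancels. What remains are the floor errors,
    -- at most 2 N W + 4 N W, and N² times two products of a zeta sum (at most 2) with a tail (at
    -- most 1/N), at most 4 N together.
    ∣∑-remainder∣≤ : 1 ℕ.≤ N → N ℕ.≤ n →
      ∣ ∑< N (λ k → remainder (M k)) ∣ ≤ fromNat 10 * (fromNat N * W N)
    ∣∑-remainder∣≤ 1≤N N≤n = begin
      ∣ ∑< N (λ k → remainder (M k)) ∣
        ≡⟨ cong ∣_∣ (trans ∑-remainder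
             (solve 7 (λ z₂ a z₁ b n² t₁ t₂ →
               z₂ :* a :- z₁ :* b :=
               (z₂ :* (a :- n² :* t₁) :- z₁ :* (b :- n² :* t₂)) :-
               (n² :* (z₂ :* (z₁ :- t₁)) :- n² :* (z₁ :* (z₂ :- t₂)))) refl
               Z₂ A Z₁ B N² (ζ-partialSum (s ℕ.+ b) N) (ζ-partialSum (b ℕ.+ b) N))) ⟩
      ∣ (Z₂ * (A - Y₁) - Z₁ * (B - Y₂)) -
        (N² * (Z₂ * (Z₁ - ζ-partialSum (s ℕ.+ b) N)) - N² * (Z₁ * (Z₂ - ζ-partialSum (b ℕ.+ b) N))) ∣
        ≤⟨ ∣-∣≤ (∣-∣≤ (∣*∣≤ ∣Z₂∣≤2 ∣A-Y₁∣≤) (∣*∣≤ ∣Z₁∣≤2 ∣B-Y₂∣≤))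
                (∣-∣≤ (∣*∣≤ ∣N²∣≤ (∣*∣≤ ∣Z₂∣≤2 (tail (s ℕ.+ b) 2≤s+b)))
                      (∣*∣≤ ∣N²∣≤ (∣*∣≤ ∣Z₁∣≤2 (tail (b ℕ.+ b) 2≤b+b)))) ⟩
      (two * NW + two * (two * NW)) + (N² * (two * ρ) + N² * (two * ρ))
        ≡⟨ solve 3 (λ y n r →
             (con two :* y :+ con two :* (con two :* y)) :+ ((n :* n) :* (con two :* r) :+ (n :* n) :* (con two :* r)) :=
             con (fromNat 6) :* y :+ con (fromNat 4) :* (n :* (r :* n))) refl NW (fromNat N) ρ ⟩
      fromNat 6 * NW + fromNat 4 * (fromNat N * (ρ * fromNat N))
        -- The first term of W is 1, so 4 N ≤ 4 N W.
        ≤⟨ ℚₚ.+-monoʳ-≤ (fromNat 6 * NW) (*-monoˡ (0≤fromNat 4) (*-monoˡ (0≤fromNat N)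
             (subst (_≤ W N) (sym (recip-inverse′ N)) (1≤ζ-partialSum s N 1≤N)))) ⟩
      fromNat 6 * NW + fromNat 4 * NW
        ≡⟨ solve 1 (λ y → con (fromNat 6) :* y :+ con (fromNat 4) :* y := con (fromNat 10) :* y) refl NW ⟩
      fromNat 10 * NW ∎
      where
      open ℚₚ.≤-Reasoning
      instance _ = ℕ.>-nonZero 1≤N
      two = fromNat 2
      NW = fromNat N * W N
      ρ = recip N
      ∣N²∣≤ : ∣ N² ∣ ≤ N²
      ∣N²∣≤ = 0≤p≤q⇒∣p∣≤q (nonNeg-* (0≤fromNat N) (0≤fromNat N)) ℚₚ.≤-refl
      tail : ∀ t → 2 ℕ.≤ t → ∣ ζ-partialSum t n - ζ-partialSum t N ∣ ≤ ρ
      tail t 2≤t = 0≤p≤q⇒∣p∣≤q (≤⇒0≤- (ζ-partialSum-mono t N≤n))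
        (p≤q+r⇒p-q≤r (ζ-partialSum t N) (ζ-tail t 2≤t N n N≤n))

    head-⌊⌋ : M 0 ≡ N
    head-⌊⌋ = trans (/-congʳ {m = N} {{ℕₚ.m^n≢0 1 b}} {{_}} (ℕₚ.^-zeroˡ b)) (n/1≡n N)

    ⌊⌋<N : 1 ℕ.≤ N → ∀ k → M (suc k) ℕ.< N
    ⌊⌋<N 1≤N k = m/n<m N ((2 ℕ.+ k) ℕ.^ b) {{ℕ.>-nonZero 1≤N}} {{ℕₚ.m^n≢0 (2 ℕ.+ k) b}}
      (ℕₚ.≤-trans (s≤s (s≤s z≤n)) (subst (ℕ._≤ (2 ℕ.+ k) ℕ.^ b) (ℕₚ.^-identityʳ (2 ℕ.+ k)) (ℕₚ.^-monoʳ-≤ (2 ℕ.+ k) {1} {b} (s≤s z≤n))))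

  -- The term e = 1 of the sum is `remainder N` itself, and all others concern smaller arguments.
  -- The constant solves C = 10 + ¾ C, whence 40, with 30 for the terms e ≥ 2.
  ∣remainder∣≤ : ∀ N → N ℕ.≤ n → ∣ remainder N ∣ ≤ fromNat 40 * (fromNat N * W N)
  ∣remainder∣≤ = <-rec _ step
    where
    open ℚₚ.≤-Reasoning
    step : ∀ N → (∀ {M} → M ℕ.< N → M ℕ.≤ n → ∣ remainder M ∣ ≤ fromNat 40 * (fromNat M * W M)) →
           N ℕ.≤ n → ∣ remainder N ∣ ≤ fromNat 40 * (fromNat N * W N)
    -- This case does occur: the floors are 0 as soon as eᵇ > N.
    step zero _ _ = ℚₚ.≤-reflexive (cong ∣_∣ (solve 2
      (λ x y → x :* (con (fromNat 2) :* con 0ℚ) :- y :* (con 0ℚ :* con 0ℚ) := con 0ℚ) refl Z₂ Z₁))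
    step N@(suc N-1) ih N≤n = begin
      ∣ remainder N ∣
        ≡⟨ cong ∣_∣ (solve 2 (λ x y → x := (x :+ y) :- y) refl (remainder N) rest) ⟩
      ∣ (remainder N + rest) - rest ∣
        ≡⟨ cong (λ t → ∣ (remainder t + rest) - rest ∣) (head-⌊⌋ N) ⟨
      ∣ (remainder (M 0) + rest) - rest ∣
        ≡⟨ cong (λ t → ∣ t - rest ∣) (∑<-head (λ k → remainder (M k)) N-1) ⟨
      ∣ ∑< N (λ k → remainder (M k)) - rest ∣
        ≤⟨ ∣-∣≤ (∣∑-remainder∣≤ N (s≤s z≤n) N≤n) ∣rest∣≤ ⟩
      fromNat 10 * NW + fromNat 30 * NW
        ≡⟨ solve 1 (λ y → con (fromNat 10) :* y :+ con (fromNat 30) :* y := con (fromNat 40) :* y) refl NW ⟩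
      fromNat 40 * NW ∎
      where
      M : ℕ → ℕ
      M k = ⌊ N /1+ k ^ b ⌋
      NW = fromNat N * W N
      rest = ∑< N-1 (λ k → remainder (M (suc k)))
      0≤NW : 0ℚ ≤ NW
      0≤NW = nonNeg-* (0≤fromNat N) (0≤ζ-partialSum s N)
      termwise : ∀ k → ∣ remainder (M (suc k)) ∣ ≤ (fromNat 40 * NW) * ζ-term b (suc k)
      termwise k = begin
        ∣ remainder (M (suc k)) ∣
          ≤⟨ ih M<N (ℕₚ.≤-trans (ℕₚ.<⇒≤ M<N) N≤n) ⟩
        fromNat 40 * (fromNat (M (suc k)) * W (M (suc k)))
          ≤⟨ *-monoˡ (0≤fromNat 40) (*-mono (0≤fromNat (M (suc k))) (0≤ζ-partialSum s N)
               (/≤*recip N ((2 ℕ.+ k) ℕ.^ b) {{ℕₚ.m^n≢0 (2 ℕ.+ k) b}})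
               (ζ-partialSum-mono s (ℕₚ.<⇒≤ M<N))) ⟩
        fromNat 40 * (fromNat N * ζ-term b (suc k) * W N)
          ≡⟨ solve 4 (λ c n r w → c :* (n :* r :* w) := (c :* (n :* w)) :* r) refl
               (fromNat 40) (fromNat N) (ζ-term b (suc k)) (W N) ⟩
        (fromNat 40 * NW) * ζ-term b (suc k) ∎
        where
        M<N : M (suc k) ℕ.< N
        M<N = ⌊⌋<N N (s≤s z≤n) k
      ∣rest∣≤ : ∣ rest ∣ ≤ fromNat 30 * NW
      ∣rest∣≤ = begin
        ∣ rest ∣
          ≤⟨ ∑<-∣∣ (λ k → remainder (M (suc k))) N-1 ⟩
        ∑< N-1 (λ k → ∣ remainder (M (suc k)) ∣)
          ≤⟨ ∑<-mono N-1 (λ k _ → termwise k) ⟩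
        ∑< N-1 (λ k → (fromNat 40 * NW) * ζ-term b (suc k))
          ≡⟨ ∑<-*ˡ (fromNat 40 * NW) (λ k → ζ-term b (suc k)) N-1 ⟩
        (fromNat 40 * NW) * ∑< N-1 (λ k → ζ-term b (suc k))
          ≤⟨ *-monoˡ (nonNeg-* (0≤fromNat 40) 0≤NW) (∑ζ-term∘suc≤¾ b (s≤s 1≤s) N-1) ⟩
        (fromNat 40 * NW) * (ℤ.+ 3 ℚ./ 4)
          ≡⟨ solve 1 (λ y → (con (fromNat 40) :* y) :* con (ℤ.+ 3 ℚ./ 4) := con (fromNat 30) :* y) refl NW ⟩
        fromNat 30 * NW ∎

-- Comparison of the harmonic sum with the logarithm series

module Logarithm where

  open import Algebra.Definitions.RawSemiring ℚ.+-*-rawSemiring using (_^_)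
  open ℚ using (_+_; _-_; _*_; _≤_)
  open +-*-Solver using (solve; _:+_; _:*_; :-_; _:-_; _:=_; con)
  open CauchyFacts
  open Sums
  open Inequalities
  open Zeta

  module _ {v : ℚ} (0≤v : 0ℚ ≤ v) (v≤1 : v ≤ 1ℚ) where

    0≤[1-v]^ : ∀ k → 0ℚ ≤ (1ℚ - v) ^ k
    0≤[1-v]^ zero    = 0≤1
    0≤[1-v]^ (suc k) = nonNeg-* (≤⇒0≤- v≤1) (0≤[1-v]^ k)

    bernoulli : ∀ k → 1ℚ - fromNat k * v ≤ (1ℚ - v) ^ k
    bernoulli zero    = ℚₚ.≤-reflexive (solve 1 (λ v → con 1ℚ :- con 0ℚ :* v := con 1ℚ) refl v)
    bernoulli (suc k) = begin
      1ℚ - (1ℚ + fromNat k) * v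
        ≤⟨ p≤p+q (nonNeg-* (0≤fromNat k) (nonNeg-* 0≤v 0≤v)) ⟩
      1ℚ - (1ℚ + fromNat k) * v + fromNat k * (v * v)
        ≡⟨ solve 2 (λ k v → con 1ℚ :- (con 1ℚ :+ k) :* v :+ k :* (v :* v) := (con 1ℚ :- v) :* (con 1ℚ :- k :* v)) refl (fromNat k) v ⟩
      (1ℚ - v) * (1ℚ - fromNat k * v)
        ≤⟨ *-monoˡ (≤⇒0≤- v≤1) (bernoulli k) ⟩
      (1ℚ - v) ^ suc k ∎
      where open ℚₚ.≤-Reasoning

    -- Bernoulli's inequality gives (1 - v)^{k+1} / (k + 1) ≥ 1/(k + 1) - v, so each of the first N
    -- terms loses at most v. The later terms are nonnegative.
    harmonic-v*N≤log : ∀ {N n} → N ℕ.≤ n → ζ-partialSum 1 N - v * fromNat N ≤ logPartialSum (1ℚ - v) n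
    harmonic-v*N≤log {N} {n} N≤n = begin
      ζ-partialSum 1 N - v * fromNat N
        ≡⟨ cong (λ t → ζ-partialSum 1 N - t) (∑<-const v N) ⟨
      ζ-partialSum 1 N - ∑< N (λ _ → v)
        ≡⟨ ∑<-- (ζ-term 1) (λ _ → v) N ⟨
      ∑< N (λ k → ζ-term 1 k - v)
        ≤⟨ ∑<-mono N (λ k _ → termwise k) ⟩
      logPartialSum (1ℚ - v) N
        ≤⟨ ∑<-mono-length (λ k → nonNeg-* (0≤[1-v]^ (suc k)) (0≤recip (suc k))) N≤n ⟩
      logPartialSum (1ℚ - v) n ∎
      where
      open ℚₚ.≤-Reasoning
      termwise : ∀ k → ζ-term 1 k - v ≤ (1ℚ - v) ^ suc k * recip (suc k)
      termwise k = begin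
        ζ-term 1 k - v
          ≡⟨ cong (_- v) (trans (ζ-term-suc 0 k) (ℚₚ.*-identityʳ r)) ⟩
        r - v
          ≡⟨ cong (λ t → r - t) (trans (sym (ℚₚ.*-identityˡ v)) (cong (_* v) (sym (recip-inverse k)))) ⟩
        r - r * fromNat (suc k) * v
          ≡⟨ solve 3 (λ r K v → r :- r :* K :* v := (con 1ℚ :- K :* v) :* r) refl r (fromNat (suc k)) v ⟩
        (1ℚ - fromNat (suc k) * v) * r
          ≤⟨ *-monoʳ (0≤recip (suc k)) (bernoulli (suc k)) ⟩
        (1ℚ - v) ^ suc k * r ∎
        where r = recip (suc k)

  -- The series loses at most N / x ≤ 3/2 against the harmonic sum, which is at least 2.
  harmonic≤4*log : ∀ {x N n} → 1ℚ ≤ x → fromNat N ≤ x + ½ → 4 ℕ.≤ N → N ℕ.≤ n →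
                   ζ-partialSum 1 N ≤ fromNat 4 * logPartialSum (logArgument x) n
  harmonic≤4*log {x} {N} {n} 1≤x N≤x+½ 4≤N N≤n = begin
    H
      -- From H ≥ 2 follows H ≤ 4 (H - 3/2); this is the origin of the factor 4.
      ≤⟨ p≤p+q (nonNeg-* (0≤fromNat 3) (≤⇒0≤- 2≤H)) ⟩
    H + fromNat 3 * (H - fromNat 2)
      ≡⟨ solve 1 (λ h → h :+ con (fromNat 3) :* (h :- con (fromNat 2)) := con (fromNat 4) :* (h :- con 3/2)) refl H ⟩
    fromNat 4 * (H - 3/2)
      ≤⟨ *-monoˡ (0≤fromNat 4) (ℚₚ.+-monoʳ-≤ H (ℚₚ.neg-antimono-≤ v*N≤3/2)) ⟩
    fromNat 4 * (H - v * fromNat N)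
      ≤⟨ *-monoˡ (0≤fromNat 4) (harmonic-v*N≤log 0≤v v≤1 N≤n) ⟩
    fromNat 4 * logPartialSum (logArgument x) n ∎
    where
    open ℚₚ.≤-Reasoning
    H = ζ-partialSum 1 N
    3/2 = ℤ.+ 3 ℚ./ 2
    v = clampedInverse 1ℚ 0<1 x
    0≤v : 0ℚ ≤ v
    0≤v = ℚₚ.<⇒≤ (0<clamped 1ℚ 0<1 x)
    v≤1 : v ≤ 1ℚ
    v≤1 = subst (_≤ 1ℚ) (ℚₚ.*-identityʳ v) (clamped-*δ 1ℚ 0<1 x)
    v*x≡1 : v * x ≡ 1ℚ
    v*x≡1 = trans (cong (v *_) (sym (ℚₚ.p≤q⇒p⊔q≡q 1≤x))) (clamped-inverseˡ 1ℚ 0<1 x)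
    2≤H : fromNat 2 ≤ H
    -- The first four terms already give 1 + 1/2 + 1/3 + 1/4 = 25/12, hence the condition N ≥ 4.
    2≤H = ℚₚ.≤-trans (ℚₚ.≤ᵇ⇒≤ tt) (ζ-partialSum-mono 1 4≤N)
    v*N≤3/2 : v * fromNat N ≤ 3/2
    v*N≤3/2 = begin
      v * fromNat N          ≤⟨ *-monoˡ 0≤v N≤x+½ ⟩
      v * (x + ½)            ≡⟨ ℚₚ.*-distribˡ-+ v x ½ ⟩
      v * x + v * ½          ≤⟨ ℚₚ.+-mono-≤ (ℚₚ.≤-reflexive v*x≡1) (*-monoʳ (ℚₚ.<⇒≤ 0<½) v≤1) ⟩
      1ℚ + 1ℚ * ½            ≡⟨⟩
      3/2 ∎

-- From f(N) to the asymptotic formula over the reals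

module Assembly where

  open ℚ using (_+_; _-_; _*_; -_; _≤_; ∣_∣)
  open +-*-Solver using (solve; _:+_; _:*_; :-_; _:-_; _:=_; con)
  open CauchyFacts
  open Sums
  open Convolution
  open Inequalities
  open Zeta
  open Logarithm

  -- The list sum `∑₁` unfolds at its first term, while `∑<` unfolds at its last; this is the
  -- bridge.
  ∑₁-suc : ∀ n f → ∑₁ (suc n) f ≡ ∑₁ n f ℕ.+ f (suc n)
  ∑₁-suc n f = begin
    ListAction.sum (map f (applyUpTo suc (suc n)))
      ≡⟨ cong (ListAction.sum ∘ map f) (applyUpTo-∷ʳ suc n) ⟨
    ListAction.sum (map f (applyUpTo suc n ++ suc n ∷ []))
      ≡⟨ cong ListAction.sum (map-++ f (applyUpTo suc n) (suc n ∷ [])) ⟩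
    ListAction.sum (map f (applyUpTo suc n) ++ f (suc n) ∷ [])
      ≡⟨ sum-++ (map f (applyUpTo suc n)) (f (suc n) ∷ []) ⟩
    ∑₁ n f ℕ.+ (f (suc n) ℕ.+ 0)
      ≡⟨ cong (∑₁ n f ℕ.+_) (ℕₚ.+-identityʳ (f (suc n))) ⟩
    ∑₁ n f ℕ.+ f (suc n) ∎
    where open ≡-Reasoning

  fromNat-∑₁ : ∀ n f → fromNat (∑₁ n f) ≡ ∑< n (λ k → fromNat (f (suc k)))
  fromNat-∑₁ zero    f = refl
  fromNat-∑₁ (suc n) f = trans (cong fromNat (∑₁-suc n f))
    (trans (fromNat-+ (∑₁ n f) (f (suc n))) (cong (_+ fromNat (f (suc n))) (fromNat-∑₁ n f)))

  fromNat-∑₁-h : ∀ b N → fromNat (∑₁ N (h b)) ≡ gcdSum b N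
  fromNat-∑₁-h b N = trans (fromNat-∑₁ N (h b))
    (∑<-cong N (λ n _ → fromNat-∑₁ (suc n) (λ j → gcd[ b ] j (suc n))))

  -- Here x is a single approximation of the real variable. The order `≤` on reals bounds
  -- approximations only up to a slack, fixed at ½; the strict bound x < N + 1 has a positive gap
  -- and survives without slack.
  module _ (s : ℕ) (1≤s : 1 ℕ.≤ s) {N n : ℕ} (1≤N : 1 ℕ.≤ N) (N≤n : N ℕ.≤ n)
           {x : ℚ} (N≤x+½ : fromNat N ≤ x + ½) (x≤1+N : x ≤ 1ℚ + fromNat N) where

    private
      b = suc s
      NW = fromNat N * ζ-partialSum s N
      coefficientₙ = seq (coefficient b (s≤s 1≤s)) n

    -- Dividing `remainder N` by 2 Z₂ gives S(N) - c N², and c (x - N)(x + N) replaces N² by x². The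
    -- constant is 40 + 2 · 3, from c ≤ 2 and x + N ≤ 1 + 2 N ≤ 3 N W.
    ∣gcdSum-c*x²∣≤ : ∣ gcdSum b N - coefficientₙ * (x * x) ∣ ≤ fromNat 46 * NW
    ∣gcdSum-c*x²∣≤ = begin
      ∣ G - c * (x * x) ∣
        ≡⟨ cong ∣_∣ split ⟩
      ∣ inv * remainder N - c * ((x - fromNat N) * (x + fromNat N)) ∣
        ≤⟨ ∣-∣≤ (∣*∣≤ ∣inv∣≤1 (∣remainder∣≤ N N≤n))
             (∣*∣≤ (∣*∣≤ ∣Z₁∣≤2 ∣inv∣≤1) (∣*∣≤ ∣x-N∣≤1 ∣x+N∣≤)) ⟩
      1ℚ * (fromNat 40 * NW) + (fromNat 2 * 1ℚ) * (1ℚ * (fromNat 3 * NW))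
        ≡⟨ solve 1 (λ y → con 1ℚ :* (con (fromNat 40) :* y) :+ (con (fromNat 2) :* con 1ℚ) :* (con 1ℚ :* (con (fromNat 3) :* y))
                     := con (fromNat 46) :* y) refl NW ⟩
      fromNat 46 * NW ∎
      where
      open ℚₚ.≤-Reasoning
      open Estimate s 1≤s n
      G = gcdSum b N
      Z₁ = ζ-partialSum (2 ℕ.* b ℕ.∸ 1) n
      Z₂ = ζ-partialSum (2 ℕ.* b) n
      -- The positivity proof `0<2ζ` carries the witness 1, so the division clamps at 1; since 2 Z₂
      -- ≥ 1, this is the true inverse.
      inv = clampedInverse 1ℚ 0<1 (ℤ.+ 2 ℚ./ 1 * Z₂)
      c = Z₁ * inv
      1≤2Z₂ : 1ℚ ≤ ℤ.+ 2 ℚ./ 1 * Z₂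
      1≤2Z₂ = ℚₚ.≤-trans {1ℚ} {ℤ.+ 2 ℚ./ 1 * 1ℚ} (ℚₚ.≤ᵇ⇒≤ tt)
        (*-monoˡ (0≤fromNat 2) (1≤ζ-partialSum (2 ℕ.* b) n (ℕₚ.≤-trans 1≤N N≤n)))
      inv*2Z₂≡1 : inv * (ℤ.+ 2 ℚ./ 1 * Z₂) ≡ 1ℚ
      inv*2Z₂≡1 = trans (cong (inv *_) (sym (ℚₚ.p≤q⇒p⊔q≡q 1≤2Z₂))) (clamped-inverseˡ 1ℚ 0<1 (ℤ.+ 2 ℚ./ 1 * Z₂))
      ∣inv∣≤1 : ∣ inv ∣ ≤ 1ℚ
      ∣inv∣≤1 = 0≤p≤q⇒∣p∣≤q (ℚₚ.<⇒≤ (0<clamped 1ℚ 0<1 (ℤ.+ 2 ℚ./ 1 * Z₂)))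
        (subst (_≤ 1ℚ) (ℚₚ.*-identityʳ inv) (clamped-*δ 1ℚ 0<1 (ℤ.+ 2 ℚ./ 1 * Z₂)))
      ∣Z₁∣≤2 : ∣ Z₁ ∣ ≤ fromNat 2
      ∣Z₁∣≤2 = 0≤p≤q⇒∣p∣≤q (0≤ζ-partialSum (2 ℕ.* b ℕ.∸ 1) n)
        (ζ-partialSum≤2 (2 ℕ.* b ℕ.∸ 1) (2≤2b∸1 b (s≤s 1≤s)) n)
      remainder≡ : remainder N ≡ Z₂ * (fromNat 2 * G) - Z₁ * (fromNat N * fromNat N)
      remainder≡ = cong (λ t → ζ-partialSum (b ℕ.+ t) n * (fromNat 2 * G) - ζ-partialSum (s ℕ.+ t) n * (fromNat N * fromNat N))
        (sym (ℕₚ.+-identityʳ b))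
      split : G - c * (x * x) ≡ inv * remainder N - c * ((x - fromNat N) * (x + fromNat N))
      split = begin-equality
        G - c * (x * x)
          ≡⟨ cong (_- c * (x * x)) (trans (sym (ℚₚ.*-identityˡ G)) (cong (_* G) (sym inv*2Z₂≡1))) ⟩
        inv * (fromNat 2 * Z₂) * G - c * (x * x)
          ≡⟨ solve 6 (λ i z₁ z₂ g n x →
               i :* (con (fromNat 2) :* z₂) :* g :- (z₁ :* i) :* (x :* x) :=
               i :* (z₂ :* (con (fromNat 2) :* g) :- z₁ :* (n :* n)) :- (z₁ :* i) :* ((x :- n) :* (x :+ n)))
               refl inv Z₁ Z₂ G (fromNat N) x ⟩
        inv * (Z₂ * (fromNat 2 * G) - Z₁ * (fromNat N * fromNat N)) - c * ((x - fromNat N) * (x + fromNat N))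
          ≡⟨ cong (λ t → inv * t - c * ((x - fromNat N) * (x + fromNat N))) remainder≡ ⟨
        inv * remainder N - c * ((x - fromNat N) * (x + fromNat N)) ∎
      ∣x-N∣≤1 : ∣ x - fromNat N ∣ ≤ 1ℚ
      ∣x-N∣≤1 = ∣p∣≤
        (p≤q+r⇒p-q≤r (fromNat N) (subst (x ≤_) (ℚₚ.+-comm 1ℚ (fromNat N)) x≤1+N))
        (subst (_≤ 1ℚ) (solve 2 (λ n x → n :- x := :- (x :- n)) refl (fromNat N) x)
          (p≤q+r⇒p-q≤r x (ℚₚ.≤-trans N≤x+½ (ℚₚ.+-monoʳ-≤ x (ℚₚ.≤ᵇ⇒≤ {½} {1ℚ} tt)))))
      ∣x+N∣≤ : ∣ x + fromNat N ∣ ≤ fromNat 3 * NW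
      ∣x+N∣≤ = begin
        ∣ x + fromNat N ∣
          ≡⟨ cong (λ t → ∣ t ∣) (solve 2 (λ x n → x :+ n := (x :- n) :+ (n :+ n)) refl x (fromNat N)) ⟩
        ∣ (x - fromNat N) + (fromNat N + fromNat N) ∣
          ≤⟨ ∣+∣≤ (ℚₚ.≤-trans ∣x-N∣≤1 (fromNat-mono 1≤N))
               (0≤p≤q⇒∣p∣≤q (ℚₚ.+-mono-≤ (0≤fromNat N) (0≤fromNat N)) ℚₚ.≤-refl) ⟩
        fromNat N + (fromNat N + fromNat N)
          ≡⟨ solve 1 (λ n → n :+ (n :+ n) := con (fromNat 3) :* (n :* con 1ℚ)) refl (fromNat N) ⟩
        fromNat 3 * (fromNat N * 1ℚ)
          ≤⟨ *-monoˡ (0≤fromNat 3) (*-monoˡ (0≤fromNat N) (1≤ζ-partialSum s N 1≤N)) ⟩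
        fromNat 3 * NW ∎

    -- From N ≥ 1 follows N ≤ 2 N - 1, and the subtracted 1 pays for the two slacks of ½.
    N≤2x : fromNat N ≤ fromNat 2 * x
    N≤2x = begin
      fromNat N                           ≤⟨ p≤p+q (≤⇒0≤- (fromNat-mono 1≤N)) ⟩
      fromNat N + (fromNat N - fromNat 1) ≤⟨ ℚₚ.+-mono-≤ N≤x+½ (ℚₚ.+-monoˡ-≤ (- fromNat 1) N≤x+½) ⟩
      x + ½ + (x + ½ - fromNat 1)         ≡⟨ solve 1 (λ x → x :+ con ½ :+ (x :+ con ½ :- con (fromNat 1)) := con (fromNat 2) :* x) refl x ⟩
      fromNat 2 * x ∎
      where open ℚₚ.≤-Reasoning

    -- Here y is the factor by which the error term exceeds x: an approximation of log x for b = 2,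
    -- and 1 for b ≥ 3. The constant is 46 · 2 · 4.
    ∣gcdSum-c*x²∣≤C*x*y : ∀ {y} → ζ-partialSum s N ≤ fromNat 4 * y →
                       ∣ gcdSum b N - coefficientₙ * (x * x) ∣ ≤ ℤ.+ 368 ℚ./ 1 * (x * y)
    ∣gcdSum-c*x²∣≤C*x*y {y} W≤4y = begin
      ∣ gcdSum b N - coefficientₙ * (x * x) ∣
        ≤⟨ ∣gcdSum-c*x²∣≤ ⟩
      fromNat 46 * NW
        ≤⟨ *-monoˡ (0≤fromNat 46) (*-mono (0≤fromNat N)
             (ℚₚ.≤-trans (0≤ζ-partialSum s N) W≤4y) N≤2x W≤4y) ⟩
      fromNat 46 * (fromNat 2 * x * (fromNat 4 * y))
        ≡⟨ solve 2 (λ x y → con (fromNat 46) :* (con (fromNat 2) :* x :* (con (fromNat 4) :* y))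
             := con (ℤ.+ 368 ℚ./ 1) :* (x :* y)) refl x y ⟩
      ℤ.+ 368 ℚ./ 1 * (x * y) ∎
      where open ℚₚ.≤-Reasoning

  ∣gcdSum-c*x²∣≤C*E : ∀ s (1≤s : 1 ℕ.≤ s) (x : ℝ) {N n} → N ℕ.≤ n →
    fromNat 5 ≤ seq x n + ½ → fromNat N ≤ seq x n + ½ → seq x n ≤ 1ℚ + fromNat N →
    ∣ gcdSum (suc s) N - seq (coefficient (suc s) (s≤s 1≤s)) n * (seq x n * seq x n) ∣ ≤
    ℤ.+ 368 ℚ./ 1 * seq (E (suc s) x) n
  ∣gcdSum-c*x²∣≤C*E s 1≤s x {N} {n} N≤n 5≤x+½ N≤x+½ x≤1+N = go s 1≤s
    where
    4≤N : 4 ℕ.≤ N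
    -- If N ≤ 3, then x ≤ 4 and 5 ≤ x + ½ ≤ 4 + ½, which is refuted by evaluation.
    4≤N = ℕₚ.≮⇒≥ λ N<4 → ℚₚ.≤⇒≤ᵇ {fromNat 5} {fromNat 4 + ½}
      (ℚₚ.≤-trans 5≤x+½ (ℚₚ.+-monoˡ-≤ ½
        (ℚₚ.≤-trans x≤1+N (ℚₚ.+-monoʳ-≤ 1ℚ (fromNat-mono (ℕₚ.≤-pred N<4))))))
    1≤N : 1 ℕ.≤ N
    1≤N = ℕₚ.≤-trans (s≤s z≤n) 4≤N
    1≤x : 1ℚ ≤ seq x n
    1≤x = ℚₚ.≤-trans {j = fromNat 5 - ½} (ℚₚ.≤ᵇ⇒≤ tt)
      (p≤q+r⇒p-q≤r ½ (subst (fromNat 5 ≤_) (ℚₚ.+-comm (seq x n) ½) 5≤x+½))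
    go : ∀ s (1≤s : 1 ℕ.≤ s) →
      ∣ gcdSum (suc s) N - seq (coefficient (suc s) (s≤s 1≤s)) n * (seq x n * seq x n) ∣ ≤
      ℤ.+ 368 ℚ./ 1 * seq (E (suc s) x) n
    go 1 1≤s = ∣gcdSum-c*x²∣≤C*x*y 1 1≤s 1≤N N≤n N≤x+½ x≤1+N
      (harmonic≤4*log 1≤x N≤x+½ 4≤N N≤n)
    -- For b ≥ 3 the exponent b - 1 is at least 2, so W ≤ 2 ≤ 4 · 1.
    go s@(suc (suc _)) 1≤s = ℚₚ.≤-trans
      (∣gcdSum-c*x²∣≤C*x*y s 1≤s 1≤N N≤n N≤x+½ x≤1+N
        (ℚₚ.≤-trans (ζ-partialSum≤2 s (s≤s (s≤s z≤n)) N) (ℚₚ.≤ᵇ⇒≤ {fromNat 2} {fromNat 4 * 1ℚ} tt)))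
      (ℚₚ.≤-reflexive (cong (ℤ.+ 368 ℚ./ 1 *_) (ℚₚ.*-identityʳ (seq x n))))

  -- Beyond a common index the rational estimate holds without slack, so the δ granted by the order
  -- is simply added. The index must also exceed N, since the zeta sums have to be truncated at n ≥
  -- N.
  floor-estimate : ∀ s (1≤s : 1 ℕ.≤ s) (x : ℝ) N → fromℕ 5 Defs.≤ x → IsFloor x N →
    Defs.∣ fromℕ (∑₁ N (h (suc s))) Defs.- coefficient (suc s) (s≤s 1≤s) Defs.* (x Defs.* x) ∣ Defs.≤
    fromℕ 368 Defs.* E (suc s) x
  floor-estimate s 1≤s x N 5≤x (N≤x , ε , 0<ε , N₃ , x+ε≤1+N) δ 0<δ =
    N ℕ.⊔ (N₁ ℕ.⊔ (N₂ ℕ.⊔ N₃)) , λ n n≥ → ℚₚ.≤-trans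
      (subst (λ t → ∣ t - seq (coefficient (suc s) (s≤s 1≤s)) n * (seq x n * seq x n) ∣ ≤
                    ℤ.+ 368 ℚ./ 1 * seq (E (suc s) x) n)
        (sym (trans (/1≡fromNat (∑₁ N (h (suc s)))) (fromNat-∑₁-h (suc s) N)))
        (∣gcdSum-c*x²∣≤C*E s 1≤s x
          (ℕₚ.m⊔n≤o⇒m≤o N _ n≥)
          (proj₂ (5≤x ½ 0<½) n (ℕₚ.m⊔n≤o⇒m≤o N₁ _ (ℕₚ.m⊔n≤o⇒n≤o N _ n≥)))
          (subst (_≤ seq x n + ½) (/1≡fromNat N)
            (proj₂ (N≤x ½ 0<½) n (ℕₚ.m⊔n≤o⇒m≤o N₂ N₃ (ℕₚ.m⊔n≤o⇒n≤o N₁ _ (ℕₚ.m⊔n≤o⇒n≤o N _ n≥)))))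
          (subst (seq x n ≤_) (/1≡fromNat (suc N)) (ℚₚ.≤-trans (p≤p+q (ℚₚ.<⇒≤ 0<ε))
            (x+ε≤1+N n (ℕₚ.m⊔n≤o⇒n≤o N₂ N₃ (ℕₚ.m⊔n≤o⇒n≤o N₁ _ (ℕₚ.m⊔n≤o⇒n≤o N _ n≥))))))))
      (p≤p+q (ℚₚ.<⇒≤ 0<δ))
    where
    N₁ = proj₁ (5≤x ½ 0<½)
    N₂ = proj₁ (N≤x ½ 0<½)

open Defs using (_-_; _*_; ∣_∣; _≤_)

theorem1p3 : (b : ℕ) (2≤b : 2 ℕ.≤ b) →
    Σ[ C ∈ ℝ ] Σ[ x₀ ∈ ℝ ] ((x : ℝ) (N : ℕ) → x₀ ≤ x → IsFloor x N →
    ∣ fromℕ (∑₁ N (h b)) - coefficient b 2≤b * (x * x) ∣ ≤ C * E b x)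
-- Both witnesses are uniform in b; x ≥ 5 serves to force N ≥ 4.
theorem1p3 (suc s) (s≤s 1≤s) = fromℕ 368 , fromℕ 5 , Assembly.floor-estimate s 1≤s
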